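{- Let $G$ be a graph and let $Q$, $R$, $S$, $T$ be subsets of $V(G)$ such that $Q\cap R=S\cap T=\emptyset$. Let $\kappa_{G}(Q,R)=k$, $\kappa_{G}(S,T)=\ell$, and $F=V(G)-(Q\cup R\cup S\cup T)$. If $|F|\geq (2\ell+1)2^{2k}$, then there exists a vertex $v$ in $F$ such that at least one of the following holds: (i) $\kappa_{G\setminus v}(Q,R)=k$ and $\kappa_{G\setminus v}(S,T)=\ell$. (ii) $\kappa_{G\wedge uv\setminus v}(Q,R)=k$ and $\kappa_{G\wedge uv\setminus v}(S,T)=\ell$ for each neighbor $u$ of $v$ in $G$.
   Context: All graphs are finite and simple (no loops or parallel edges). $G\setminus v$ denotes the graph obtained from $G$ by deleting the vertex $v$. For a vertex $v$ of $G$, $G*v$ denotes the local complementation of $G$ at $v$: the graph on the same vertex set obtained from $G$ by, for each pair $x,y$ of distinct neighbors of $v$, adding the edge $xy$ if $x,y$ are non-adjacent in $G$ and removing it otherwise. For an edge $uv$ of $G$, pivoting $uv$ gives $G\wedge uv=G*u*v*u$ (operations applied left to right; this equals $G*v*u*v$). For $X\subseteq V(G)$, the cut-rank $\rho_G(X)$ is the rank over $\mathrm{GF}(2)$ of the $X\times (V(G)-X)$ matrix whose $(i,j)$-entry is $1$ if $i$ and $j$ are adjacent in $G$ and $0$ otherwise. For disjoint $S,T\subseteq V(G)$, the connectivity between $S$ and $T$ is $\kappa_G(S,T)=\min_{S\subseteq X\subseteq V(G)-T}\rho_G(X)$. -}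

module Defs where

open import Algebra.Bundles using (CommutativeRing)
import Algebra.Properties.Monoid.Sum as MonoidSum
open import Data.Bool.Base using (Bool; true; false; _∧_; _xor_; not; T)
open import Data.Bool.Properties as Bool
  using (xor-∧-commutativeRing; ∧-comm; ∧-zeroʳ; T-∧)
open import Data.Fin.Base using (Fin)
open import Data.Fin.Properties using (_≟_; all?)
open import Data.Fin.Subset
  using (Subset; inside; outside; _∈_; _⊆_; _─_; _-_; ∣_∣; Nonempty)
open import Data.Fin.Subset.Properties
  using (_∈?_; _⊆?_; nonempty?; anySubset?; x∈p∧x≢y⇒x∈p-y)
open import Data.List.Base using (List; []; _∷_; _++_; map; filter)
open import Data.List.Extrema.Nat using (min; max)
open import Data.Nat.Base using (ℕ; zero; suc)
open import Data.Product.Base using (∃; _×_; _,_)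
open import Data.Unit.Base using (tt)
open import Data.Vec.Base using ([]; _∷_; lookup)
open import Function.Bundles using (Equivalence)
open import Relation.Binary.PropositionalEquality
  using (_≡_; _≢_; refl; sym; trans; cong; cong₂; subst)
open import Relation.Nullary using (¬_; Dec; yes; no; does; contradiction)
open import Relation.Nullary.Decidable using (_×-dec_; _→-dec_; ¬?)

private
  variable
    m n : ℕ

-- A finite simple graph whose vertex set V is a finite subset of the ambient
-- set Fin n.  Keeping the ambient set fixed lets a set of vertices of G that
-- avoids v be used unchanged as a set of vertices of G ∖ v.
record Graph (n : ℕ) : Set where
  field
    V          : Subset n
    adj        : Fin n → Fin n → Bool
    adj-sym    : ∀ x y → adj x y ≡ adj y x
    adj-irrefl : ∀ x → adj x x ≡ false
    adj-V      : ∀ x y → T (adj x y) → x ∈ V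

open Graph public

Adjacent : Graph n → Fin n → Fin n → Set
Adjacent G x y = T (adj G x y)

_==_ : Fin n → Fin n → Bool
x == y = does (x ≟ y)

private
  ==-sym : (x y : Fin n) → (x == y) ≡ (y == x)
  ==-sym x y with x ≟ y | y ≟ x
  ... | yes _   | yes _   = refl
  ... | no _    | no _    = refl
  ... | yes x≡y | no y≢x  = contradiction (sym x≡y) y≢x
  ... | no x≢y  | yes y≡x = contradiction (sym y≡x) x≢y

  ==-refl : (x : Fin n) → (x == x) ≡ true
  ==-refl x with x ≟ x
  ... | yes _  = refl
  ... | no x≢x = contradiction refl x≢x

  not-==⇒≢ : (x y : Fin n) → T (not (x == y)) → x ≢ y
  not-==⇒≢ x y t with x ≟ y
  ... | no x≢y = x≢y

infixl 7 _∖_ _*_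

_∖_ : Graph n → Fin n → Graph n
G ∖ v = record
  { V          = V G - v
  ; adj        = λ x y → adj G x y ∧ (not (x == v) ∧ not (y == v))
  ; adj-sym    = λ x y → cong₂ _∧_ (adj-sym G x y) (∧-comm (not (x == v)) _)
  ; adj-irrefl = λ x → cong (_∧ _) (adj-irrefl G x)
  ; adj-V      = λ x y t →
      let (xy , t′) = Equivalence.to T-∧ t
          (x≠v , _) = Equivalence.to T-∧ t′
      in x∈p∧x≢y⇒x∈p-y (adj-V G x y xy) (not-==⇒≢ x v x≠v)
  }

-- Local complementation: xor-ing toggles the adjacency of distinct x and y
-- exactly when both are neighbours of v.
_*_ : Graph n → Fin n → Graph n
_*_ {n} G v = record
  { V          = V G
  ; adj        = λ x y → adj G x y xor flips x y
  ; adj-sym    = λ x y → cong₂ _xor_ (adj-sym G x y) (flips-sym x y)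
  ; adj-irrefl = λ x → cong₂ _xor_ (adj-irrefl G x) (flips-irrefl x)
  ; adj-V      = support
  }
  where
  flips : Fin n → Fin n → Bool
  flips x y = (adj G v x ∧ adj G v y) ∧ not (x == y)

  flips-sym : ∀ x y → flips x y ≡ flips y x
  flips-sym x y = cong₂ _∧_ (∧-comm (adj G v x) _) (cong not (==-sym x y))

  flips-irrefl : ∀ x → flips x x ≡ false
  flips-irrefl x = trans (cong (λ b → _ ∧ not b) (==-refl x)) (∧-zeroʳ _)

  support : ∀ x y → T (adj G x y xor flips x y) → x ∈ V G
  support x y t with adj G x y in xy | adj G v x in vx
  ... | true  | _    = adj-V G x y (subst T (sym xy) tt)
  ... | false | true = adj-V G x v (subst T (trans (sym vx) (adj-sym G v x)) tt)

pivot : Graph n → Fin n → Fin n → Graph n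
pivot G u v = G * u * v * u

subsets : (n : ℕ) → List (Subset n)
subsets zero    = [] ∷ []
subsets (suc n) = map (outside ∷_) (subsets n) ++ map (inside ∷_) (subsets n)

-- Matrices over GF(2), realised as Bool with xor as addition and ∧ as
-- multiplication.
Matrix : ℕ → ℕ → Set
Matrix m n = Fin m → Fin n → Bool

open MonoidSum (CommutativeRing.+-monoid xor-∧-commutativeRing) public
  using (sum)

-- The j-th entry of Σᵢ cᵢ · rowᵢ; a coefficient vector c over GF(2) is the
-- same thing as a subset of the row indices.
combination : Matrix m n → Subset m → Fin n → Bool
combination M c j = sum (λ i → lookup c i ∧ M i j)

-- The rows indexed by I, restricted to the columns in Y, are linearly
-- dependent: some nonzero combination of them vanishes.
Dependent : Matrix m n → Subset n → Subset m → Set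
Dependent M Y I =
  ∃ λ c → c ⊆ I × Nonempty c × (∀ j → j ∈ Y → combination M c j ≡ false)

Independent : Matrix m n → Subset n → Subset m → Set
Independent M Y I = ¬ Dependent M Y I

independent? : (M : Matrix m n) (Y : Subset n) (I : Subset m) →
               Dec (Independent M Y I)
independent? M Y I = ¬? (anySubset? λ c →
  c ⊆? I ×-dec nonempty? c ×-dec
  all? (λ j → j ∈? Y →-dec combination M c j Bool.≟ false))

-- The rank of the X × Y submatrix: the maximum size of an independent set of
-- its rows.  (The empty set is independent, so 0 is attained.)
rank : Matrix m n → Subset m → Subset n → ℕ
rank {m} M X Y = max 0 (map ∣_∣ (filter admissible? (subsets m)))
  where
  admissible? : (I : Subset m) → Dec (I ⊆ X × Independent M Y I)
  admissible? I = I ⊆? X ×-dec independent? M Y I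

cutRank : Graph n → Subset n → ℕ
cutRank G X = rank (adj G) X (V G ─ X)

-- For disjoint S, T ⊆ V G, S itself satisfies S ⊆ S ⊆ V G ─ T, so taking
-- cutRank G S as the initial value of the minimum does not change it.
κ : Graph n → Subset n → Subset n → ℕ
κ {n} G S T = min (cutRank G S) (map (cutRank G) (filter between? (subsets n)))
  where
  between? : (X : Subset n) → Dec (S ⊆ X × X ⊆ V G ─ T)
  between? X = S ⊆? X ×-dec X ⊆? (V G ─ T)

{-# OPTIONS --safe #-}
module Submission where

-- Fix v outside Q, R, S and T.  Deletion of v and pivoting before deletion
-- cannot both lower κ(Q , R), and likewise for κ(S , T).  So if every v is bad,
-- then each v lies between two minimum (Q , R)-cuts A ⊂ A ∪ v and between two
-- minimum (S , T)-cuts B ⊂ B ∪ v, obstructed in different ways, and this makes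
-- the cut-rank of every set cut out by A and B grow when v is added to it.
-- Uncrossing turns the minimum cuts on either side into a chain, so the bad
-- vertices are points in two linear orders.
--
-- A core U of 2ℓ elements of S ∪ T carries the connectivity ℓ, and it splits
-- the first order into 2ℓ + 1 classes.  Attach to v the cut-ranks of E ∩ B and
-- E ─ (B ∪ v), where E is the part of A gained since the start of the class.  As
-- in the Erdős–Szekeres theorem this pair determines v within its class, because
-- from one point to a later one at least one of the two increases.  Both are
-- smaller than 2k by submodularity (smaller than k in the first class), so there
-- are fewer than (2ℓ + 1)(2k)² ≤ (2ℓ + 1) 2²ᵏ bad vertices.

open import Defs using
  ( Graph; V; adj; adj-sym; adj-irrefl; adj-V; Adjacent; _∖_; pivot; κ; cutRank
  ; Matrix; sum; combination; Independent; independent?; rank; subsets )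
  renaming (_*_ to _✶_)
open import Algebra.Bundles using (CommutativeRing)
import Algebra.Lattice.Properties.BooleanAlgebra as BooleanAlgebraProperties
import Algebra.Properties.Semiring.Sum as SemiringSum
open import Data.Bool.Base as Bool using (Bool; true; false; _∧_; _xor_)
open import Data.Bool.Properties as Bool using (T-≡; xor-∧-commutativeRing)
open import Data.Empty using (⊥-elim)
open import Data.Fin.Base using (Fin; zero; suc; fromℕ<; combine)
open import Data.Fin.Properties as Fin using (_≟_)
open import Data.Fin.Subset
open import Data.Fin.Subset.Properties
open import Data.List.Base using (List; []; _∷_; allFin; filter; map)
open import Data.List.Extrema.Nat using (xs≤max; max≤v⁺; min≤xs; argmin-sel)
open import Data.List.Membership.Propositional using () renaming (_∈_ to _∈ₗ_)
open import Data.List.Membership.Propositional.Properties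
  using (∈-map⁺; ∈-map⁻; ∈-++⁺ˡ; ∈-++⁺ʳ; ∈-filter⁺; ∈-filter⁻; ∈-allFin)
import Data.List.Relation.Unary.All as All
open import Data.List.Relation.Unary.Any as Any using (here; there)
open import Data.Nat.Base using (ℕ; zero; suc; _+_; _*_; _∸_; _^_; _≤_; _<_; _≥_; z≤n; s≤s)
open import Data.Nat.Properties as ℕ hiding (_≟_)
open import Algebra.Properties.CommutativeSemigroup +-commutativeSemigroup using (interchange)
open import Data.Product.Base using (∃; _×_; _,_; proj₁; proj₂)
open import Data.Sum.Base as Sum using (_⊎_; inj₁; inj₂; [_,_]′)
open import Data.Vec.Base using ([]; _∷_; here; there; lookup; zipWith)
open import Data.Vec.Properties using (lookup-zipWith)
open import Function.Base using (_∘_; id; flip)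
open import Function.Bundles using (Equivalence)
open import Relation.Binary.PropositionalEquality
  using (_≡_; _≢_; refl; sym; trans; cong; cong₂; subst; module ≡-Reasoning)
open import Relation.Nullary using (¬_; Dec; yes; no; does; contradiction)
open import Relation.Nullary.Decidable using (_×-dec_; _⊎-dec_; _→-dec_; ¬?; dec-false; decidable-stable)

private
  variable
    m n : ℕ

-- Subspaces of the space of subsets under symmetric difference

module 𝔽₂ = CommutativeRing xor-∧-commutativeRing
module Σ𝔽₂ = SemiringSum 𝔽₂.semiring

infixl 6 _⊕_

_⊕_ : Subset m → Subset m → Subset m
_⊕_ = zipWith _xor_

⊕-assoc : (a b c : Subset m) → (a ⊕ b) ⊕ c ≡ a ⊕ (b ⊕ c)
⊕-assoc []      []      []      = refl
⊕-assoc (x ∷ a) (y ∷ b) (z ∷ c) = cong₂ _∷_ (Bool.xor-assoc x y z) (⊕-assoc a b c)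

⊕-comm : (a b : Subset m) → a ⊕ b ≡ b ⊕ a
⊕-comm []      []      = refl
⊕-comm (x ∷ a) (y ∷ b) = cong₂ _∷_ (Bool.xor-comm x y) (⊕-comm a b)

⊕-self : (a : Subset m) → a ⊕ a ≡ ⊥
⊕-self []      = refl
⊕-self (x ∷ a) = cong₂ _∷_ (Bool.xor-same x) (⊕-self a)

⊕-⊥ : (a : Subset m) → a ⊕ ⊥ ≡ a
⊕-⊥ []      = refl
⊕-⊥ (x ∷ a) = cong₂ _∷_ (Bool.xor-identityʳ x) (⊕-⊥ a)

⊕-cancelʳ : (a b : Subset m) → (a ⊕ b) ⊕ b ≡ a
⊕-cancelʳ a b = trans (⊕-assoc a b b) (trans (cong (a ⊕_) (⊕-self b)) (⊕-⊥ a))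

⊕-⊆ : {a b p : Subset m} → a ⊆ p → b ⊆ p → a ⊕ b ⊆ p
⊕-⊆ {a = a} {b} {p} a⊆p b⊆p {x} x∈ with x ∈? a | x ∈? b
... | yes x∈a | _       = a⊆p x∈a
... | no _    | yes x∈b = b⊆p x∈b
... | no x∉a  | no x∉b  = contradiction x∈ (⊕-∉ a b x∉a x∉b)
  where
  ⊕-∉ : (a b : Subset m) {x : Fin m} → x ∉ a → x ∉ b → x ∉ a ⊕ b
  ⊕-∉ (true  ∷ a) (y     ∷ b) {zero}  x∉a x∉b x∈           = x∉a here
  ⊕-∉ (false ∷ a) (true  ∷ b) {zero}  x∉a x∉b x∈           = x∉b here
  ⊕-∉ (_     ∷ a) (_     ∷ b) {suc x} x∉a x∉b (there x∈) =
    ⊕-∉ a b (drop-not-there x∉a) (drop-not-there x∉b) x∈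

record Subspace (m : ℕ) : Set₁ where
  infix 4 _∋_
  field
    _∋_ : Subset m → Set
    ∋?  : ∀ c → Dec (_∋_ c)
    ∋-⊥ : _∋_ ⊥
    ∋-⊕ : ∀ {c d} → _∋_ c → _∋_ d → _∋_ (c ⊕ d)

open Subspace public using (_∋_; ∋?; ∋-⊥; ∋-⊕)

infix 4 _≤ˢ_

_≤ˢ_ : Subspace m → Subspace m → Set
K ≤ˢ L = ∀ {c} → K ∋ c → L ∋ c

restrict : Subspace (suc m) → Subspace m
restrict K = record
  { _∋_ = λ c → K ∋ outside ∷ c
  ; ∋?  = λ c → ∋? K (outside ∷ c)
  ; ∋-⊥ = ∋-⊥ K
  ; ∋-⊕ = ∋-⊕ K
  }

leads? : (K : Subspace (suc m)) → Dec (∃ λ c → K ∋ inside ∷ c)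
leads? K = anySubset? (λ c → ∋? K (inside ∷ c))

-- The positions of the leading ones of an echelon basis.
pivots : Subspace m → Subset m
pivots {zero}  K = []
pivots {suc m} K = does (leads? K) ∷ pivots (restrict K)

dim : Subspace m → ℕ
dim K = ∣ pivots K ∣

dim-mono : (K L : Subspace m) → K ≤ˢ L → dim K ≤ dim L
dim-mono {zero}  K L K≤L = z≤n
dim-mono {suc m} K L K≤L with leads? K | leads? L
... | yes _       | yes _ = s≤s (dim-mono (restrict K) (restrict L) K≤L)
... | yes (c , k) | no ¬l = contradiction (c , K≤L k) ¬l
... | no _        | yes _ = m≤n⇒m≤1+n (dim-mono (restrict K) (restrict L) K≤L)
... | no _        | no _  = dim-mono (restrict K) (restrict L) K≤L

-- If both spaces lead at the first coordinate and `w` does too, adding a leading vector of `K` to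
-- `w` moves the question to the restricted spaces.
dim-strict : (K L : Subspace m) → K ≤ˢ L → ∀ {w} → L ∋ w → ¬ K ∋ w → dim K < dim L
dim-strict {zero}  K L K≤L {[]} _ ∌w = contradiction (∋-⊥ K) ∌w
dim-strict {suc m} K L K≤L {b ∷ w} ∋w ∌w with leads? K | leads? L
... | yes (c , k) | no ¬l = contradiction (c , K≤L k) ¬l
... | no _        | yes _ = s≤s (dim-mono (restrict K) (restrict L) K≤L)
dim-strict {suc m} K L K≤L {true ∷ w} ∋w ∌w | no _ | no ¬l = contradiction (w , ∋w) ¬l
dim-strict {suc m} K L K≤L {false ∷ w} ∋w ∌w | no _ | no _ =
  dim-strict (restrict K) (restrict L) K≤L ∋w ∌w
dim-strict {suc m} K L K≤L {false ∷ w} ∋w ∌w | yes _ | yes _ =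
  s≤s (dim-strict (restrict K) (restrict L) K≤L ∋w ∌w)
dim-strict {suc m} K L K≤L {true ∷ w} ∋w ∌w | yes (c , k) | yes _ =
  s≤s (dim-strict (restrict K) (restrict L) K≤L (∋-⊕ L ∋w (K≤L k))
    (λ ∋wc → ∌w (subst (λ z → K ∋ true ∷ z) (⊕-cancelʳ w c) (∋-⊕ K ∋wc k))))

-- The span of `K` and `w`: over GF(2) it consists of just two cosets of `K`.
adjoin : Subspace m → Subset m → Subspace m
adjoin K w = record
  { _∋_ = λ c → K ∋ c ⊎ K ∋ c ⊕ w
  ; ∋?  = λ c → ∋? K c ⊎-dec ∋? K (c ⊕ w)
  ; ∋-⊥ = inj₁ (∋-⊥ K)
  ; ∋-⊕ = closed
  }
  where
  shift : ∀ c d → (c ⊕ w) ⊕ d ≡ (c ⊕ d) ⊕ w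
  shift c d = trans (⊕-assoc c w d) (trans (cong (c ⊕_) (⊕-comm w d)) (sym (⊕-assoc c d w)))

  closed : ∀ {c d} → K ∋ c ⊎ K ∋ c ⊕ w → K ∋ d ⊎ K ∋ d ⊕ w → K ∋ c ⊕ d ⊎ K ∋ (c ⊕ d) ⊕ w
  closed (inj₁ c∈) (inj₁ d∈) = inj₁ (∋-⊕ K c∈ d∈)
  closed {c} {d} (inj₁ c∈) (inj₂ d∈) = inj₂ (subst (K ∋_) (sym (⊕-assoc c d w)) (∋-⊕ K c∈ d∈))
  closed {c} {d} (inj₂ c∈) (inj₁ d∈) = inj₂ (subst (K ∋_) (shift c d) (∋-⊕ K c∈ d∈))
  closed {c} {d} (inj₂ c∈) (inj₂ d∈) = inj₁ (subst (K ∋_)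
    (trans (sym (⊕-assoc (c ⊕ w) d w)) (trans (cong (_⊕ w) (shift c d)) (⊕-cancelʳ (c ⊕ d) w)))
    (∋-⊕ K c∈ d∈))

-- `I` and `U` stand for the intersection and the sum; asking only for inclusions avoids
-- constructing a sum of subspaces. The induction compares which of the four spaces lead at the
-- first coordinate.
dim-modular : (K L I U : Subspace m) →
              (∀ {c} → K ∋ c → L ∋ c → I ∋ c) → K ≤ˢ U → L ≤ˢ U →
              dim K + dim L ≤ dim I + dim U
dim-modular {zero}  K L I U K∩L≤I K≤U L≤U = z≤n
dim-modular {suc m} K L I U K∩L≤I K≤U L≤U
  with rec ← dim-modular (restrict K) (restrict L) (restrict I) (restrict U) K∩L≤I K≤U L≤U
  with leads? K | leads? L | leads? I | leads? U
... | yes (c , k) | _ | _ | no ¬u = contradiction (c , K≤U k) ¬u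
... | _ | yes (c , l) | _ | no ¬u = contradiction (c , L≤U l) ¬u
... | no _ | no _ | no _  | no _ = rec
... | no _ | no _ | yes _ | no _ = m≤n⇒m≤1+n rec
... | no _ | no _ | no _  | yes _ = ≤-trans rec (+-monoʳ-≤ _ (n≤1+n _))
... | no _ | no _ | yes _ | yes _ = m≤n⇒m≤1+n (≤-trans rec (+-monoʳ-≤ _ (n≤1+n _)))
... | yes _ | no _ | no _  | yes _ = ≤-trans (s≤s rec) (≤-reflexive (sym (+-suc _ _)))
... | yes _ | no _ | yes _ | yes _ = s≤s (≤-trans rec (+-monoʳ-≤ _ (n≤1+n _)))
... | no _ | yes _ | no _  | yes _ =
  ≤-trans (≤-reflexive (+-suc _ _)) (≤-trans (s≤s rec) (≤-reflexive (sym (+-suc _ _))))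
... | no _ | yes _ | yes _ | yes _ =
  ≤-trans (≤-reflexive (+-suc _ _)) (s≤s (≤-trans rec (+-monoʳ-≤ _ (n≤1+n _))))
... | yes _ | yes _ | yes _ | yes _ =
  s≤s (≤-trans (≤-reflexive (+-suc _ _)) (≤-trans (s≤s rec) (≤-reflexive (sym (+-suc _ _)))))
... | yes (c , k) | yes (d , l) | no ¬i | yes _ =
  -- No vector of K ∩ L has a leading one, so the difference of the two leading
  -- vectors is a direction of U outside K₀ + L₀.
  ≤-trans (s≤s (≤-trans (+-monoʳ-≤ _ L₀<L₁)
                 (dim-modular (restrict K) L₁ (restrict I) (restrict U) meet K≤U join)))
          (≤-reflexive (sym (+-suc _ _)))
  where
  w = c ⊕ d
  L₁ = adjoin (restrict L) w

  lead : ∀ {z} → K ∋ false ∷ z → L ∋ false ∷ (z ⊕ w) → I ∋ true ∷ (z ⊕ c)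
  lead {z} kz lz = K∩L≤I (∋-⊕ K kz k) (subst (λ y → L ∋ true ∷ y) eq (∋-⊕ L lz l))
    where
    eq : (z ⊕ w) ⊕ d ≡ z ⊕ c
    eq = trans (⊕-assoc z w d) (cong (z ⊕_) (⊕-cancelʳ c d))

  w∉L₀ : ¬ L ∋ false ∷ w
  w∉L₀ lw = ¬i (_ , lead (∋-⊥ K) (subst (λ y → L ∋ false ∷ y)
    (sym (trans (⊕-comm ⊥ w) (⊕-⊥ w))) lw))

  L₀<L₁ : dim (restrict L) < dim L₁
  L₀<L₁ = dim-strict (restrict L) L₁ inj₁
    (inj₂ (subst (λ y → L ∋ false ∷ y) (sym (⊕-self w)) (∋-⊥ L))) w∉L₀

  meet : ∀ {z} → K ∋ false ∷ z → L₁ ∋ z → I ∋ false ∷ z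
  meet kz (inj₁ lz) = K∩L≤I kz lz
  meet kz (inj₂ lz) = contradiction (_ , lead kz lz) ¬i

  join : L₁ ≤ˢ restrict U
  join (inj₁ lz) = L≤U lz
  join {z} (inj₂ lz) = subst (λ y → U ∋ false ∷ y) (⊕-cancelʳ z w)
    (∋-⊕ U (L≤U lz) (∋-⊕ U (K≤U k) (L≤U l)))

-- The kernel of a functional has codimension at most one. If `K` leads and `L` does not, then `φ`
-- is true on a leading vector of `K`. A vector of `restrict K` with `φ` true could be added to it
-- to make `L` lead, so nothing else is lost.
dim-hyperplane : (K L : Subspace m) (φ : Subset m → Bool) →
                 (∀ c d → φ (c ⊕ d) ≡ φ c xor φ d) →
                 (∀ {c} → K ∋ c → φ c ≡ false → L ∋ c) →
                 dim K ≤ suc (dim L)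
dim-hyperplane {zero}  K L φ φ-⊕ K≤L = z≤n
dim-hyperplane {suc m} K L φ φ-⊕ K≤L
  with rec ← dim-hyperplane (restrict K) (restrict L) (φ ∘ (false ∷_)) (λ c d → φ-⊕ _ _) K≤L
  with leads? K | leads? L
... | no _  | no _  = rec
... | no _  | yes _ = m≤n⇒m≤1+n rec
... | yes _ | yes _ = s≤s rec
... | yes (c , k) | no ¬l = s≤s (dim-mono (restrict K) (restrict L) K₀≤L₀)
  where
  φk : φ (true ∷ c) ≡ true
  φk with φ (true ∷ c) in eq
  ... | true  = refl
  ... | false = contradiction (c , K≤L k eq) ¬l

  K₀≤L₀ : restrict K ≤ˢ restrict L
  K₀≤L₀ {z} kz with φ (false ∷ z) in eq
  ... | false = K≤L kz eq
  ... | true  = contradiction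
    (_ , K≤L (∋-⊕ K kz k) (trans (φ-⊕ (false ∷ z) (true ∷ c)) (cong₂ _xor_ eq φk))) ¬l

powerSpace : Subset m → Subspace m
powerSpace p = record
  { _∋_ = _⊆ p
  ; ∋?  = _⊆? p
  ; ∋-⊥ = ⊥⊆
  ; ∋-⊕ = ⊕-⊆
  }

pivots-⊆ : (K : Subspace m) {p : Subset m} → (∀ {c} → K ∋ c → c ⊆ p) → pivots K ⊆ p
pivots-⊆ {suc m} K {b ∷ p} K⊆p x∈ with leads? K
pivots-⊆ {suc m} K {b ∷ p} K⊆p here       | yes (c , k) = K⊆p k here
pivots-⊆ {suc m} K {b ∷ p} K⊆p (there x∈) | _ =
  there (pivots-⊆ (restrict K) (λ k → drop-∷-⊆ (K⊆p k)) x∈)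

dim-powerSpace-≤ : (p : Subset m) → dim (powerSpace p) ≤ ∣ p ∣
dim-powerSpace-≤ p = p⊆q⇒∣p∣≤∣q∣ (pivots-⊆ (powerSpace p) id)

dim-powerSpace-≥ : (p : Subset m) → ∣ p ∣ ≤ dim (powerSpace p)
dim-powerSpace-≥ []          = z≤n
dim-powerSpace-≥ (false ∷ p) = ≤-trans (dim-powerSpace-≥ p) (≤-trans
  (dim-mono (powerSpace p) (restrict (powerSpace (false ∷ p))) out⊆)
  (∣p∣≤∣x∷p∣ (does (leads? (powerSpace (false ∷ p)))) (pivots (restrict (powerSpace (false ∷ p))))))
dim-powerSpace-≥ (true ∷ p) with leads? (powerSpace (true ∷ p))
... | yes _ = s≤s (≤-trans (dim-powerSpace-≥ p)
  (dim-mono (powerSpace p) (restrict (powerSpace (true ∷ p))) out⊆))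
... | no ¬l = ⊥-elim (¬l (p , λ x∈ → x∈))

dim-zero : (K : Subspace m) → (∀ {c} → K ∋ c → Empty c) → dim K ≡ 0
dim-zero {zero}  K K≤0 = refl
dim-zero {suc m} K K≤0 with leads? K
... | yes (c , k) = contradiction (zero , here) (K≤0 k)
... | no _        = dim-zero (restrict K) (λ k → drop-∷-Empty (K≤0 k))

-- The first element of a nonempty member of `K` is a pivot.
pivot-free : (K : Subspace m) {c : Subset m} → K ∋ c → (∀ {x} → x ∈ pivots K → x ∉ c) → Empty c
pivot-free {suc m} K {b ∷ c} k free (x , x∈) with leads? K
pivot-free {suc m} K {true ∷ c} k free (x , x∈) | yes _ = free here here
pivot-free {suc m} K {true ∷ c} k free (x , x∈) | no ¬l = ¬l (c , k)
pivot-free {suc m} K {false ∷ c} k free (suc x , there x∈) | _ =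
  pivot-free (restrict K) k (λ p∈ c∈ → free (there p∈) (there c∈)) (x , x∈)

-- Gaussian elimination from left to right: vectors added later are zero at the positions already
-- treated, so cleared pivots stay cleared.
reduce : (K : Subspace m) (c : Subset m) →
         ∃ λ k → K ∋ k × (∀ {x} → x ∈ pivots K → x ∉ c ⊕ k)
reduce {zero}  K [] = [] , ∋-⊥ K , λ ()
reduce {suc m} K (b ∷ c) with leads? K | b
... | no _ | b = let (k , k∈ , free) = reduce (restrict K) c in
  false ∷ k , k∈ , λ { (there p) (there q) → free p q }
... | yes _ | false = let (k , k∈ , free) = reduce (restrict K) c in
  false ∷ k , k∈ , λ { (there p) (there q) → free p q }
... | yes (l , l∈) | true = let (k , k∈ , free) = reduce (restrict K) (c ⊕ l) in
  true ∷ (l ⊕ k) , ∋-⊕ K l∈ k∈ ,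
  λ { (there p) (there q) → free p (subst (_ ∈_) (sym (⊕-assoc c l k)) q) }

-- Rank over GF(2)

⟨_,_⟩ : Subset m → (Fin m → Bool) → Bool
⟨ c , f ⟩ = sum (λ i → lookup c i ∧ f i)

⟨,⟩-cong : (c : Subset m) {f g : Fin m → Bool} → (∀ {i} → i ∈ c → f i ≡ g i) → ⟨ c , f ⟩ ≡ ⟨ c , g ⟩
⟨,⟩-cong []          f≡g = refl
⟨,⟩-cong (false ∷ c) f≡g = ⟨,⟩-cong c (f≡g ∘ there)
⟨,⟩-cong (true  ∷ c) f≡g = cong₂ _xor_ (f≡g here) (⟨,⟩-cong c (f≡g ∘ there))

⟨,⟩-false : (c : Subset m) → ⟨ c , (λ _ → false) ⟩ ≡ false
⟨,⟩-false []          = refl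
⟨,⟩-false (false ∷ c) = ⟨,⟩-false c
⟨,⟩-false (true  ∷ c) = ⟨,⟩-false c

⟨,⟩-zero : (c : Subset m) (f : Fin m → Bool) → (∀ {i} → i ∈ c → f i ≡ false) → ⟨ c , f ⟩ ≡ false
⟨,⟩-zero c f f≡0 = trans (⟨,⟩-cong c f≡0) (⟨,⟩-false c)

⟨,⟩-⊕ : (c d : Subset m) (f : Fin m → Bool) → ⟨ c ⊕ d , f ⟩ ≡ ⟨ c , f ⟩ xor ⟨ d , f ⟩
⟨,⟩-⊕ c d f = trans
  (Σ𝔽₂.sum-cong-≗ (λ i → trans (cong (_∧ f i) (lookup-zipWith _xor_ i c d))
                              (𝔽₂.distribʳ (f i) (lookup c i) (lookup d i))))
  (Σ𝔽₂.∑-distrib-+ (λ i → lookup c i ∧ f i) (λ i → lookup d i ∧ f i))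

⟨,⟩-xor : (c : Subset m) (f g : Fin m → Bool) →
          ⟨ c , (λ i → f i xor g i) ⟩ ≡ ⟨ c , f ⟩ xor ⟨ c , g ⟩
⟨,⟩-xor c f g = trans
  (Σ𝔽₂.sum-cong-≗ (λ i → 𝔽₂.distribˡ (lookup c i) (f i) (g i)))
  (Σ𝔽₂.∑-distrib-+ (λ i → lookup c i ∧ f i) (λ i → lookup c i ∧ g i))

⟨,⟩-∧ : (c : Subset m) (f : Fin m → Bool) (b : Bool) → ⟨ c , (λ i → f i ∧ b) ⟩ ≡ ⟨ c , f ⟩ ∧ b
⟨,⟩-∧ c f b = trans
  (Σ𝔽₂.sum-cong-≗ (λ i → sym (Bool.∧-assoc (lookup c i) (f i) b)))
  (sym (Σ𝔽₂.*-distribʳ-sum b (λ i → lookup c i ∧ f i)))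

⟨,⟩-swap : (c : Subset m) (d : Subset n) (M : Matrix m n) →
           ⟨ d , combination M c ⟩ ≡ ⟨ c , combination (flip M) d ⟩
⟨,⟩-swap c d M = trans
  (Σ𝔽₂.sum-cong-≗ (λ j → Σ𝔽₂.*-distribˡ-sum (lookup d j) (λ i → lookup c i ∧ M i j)))
  (trans (Σ𝔽₂.∑-comm (λ j i → lookup d j ∧ (lookup c i ∧ M i j)))
  (Σ𝔽₂.sum-cong-≗ (λ i → trans
    (Σ𝔽₂.sum-cong-≗ (λ j → exchange (lookup d j) (lookup c i) (M i j)))
    (sym (Σ𝔽₂.*-distribˡ-sum (lookup c i) (λ j → lookup d j ∧ M i j))))))
  where
  exchange : ∀ x y z → x ∧ (y ∧ z) ≡ y ∧ (x ∧ z)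
  exchange x y z = trans (sym (Bool.∧-assoc x y z)) (trans (cong (_∧ z) (Bool.∧-comm x y)) (Bool.∧-assoc y x z))

⟨,⟩-singleton : (x : Fin m) (f : Fin m → Bool) → ⟨ ⁅ x ⁆ , f ⟩ ≡ f x
⟨,⟩-singleton {suc m} zero f = trans
  (cong (f zero xor_) (⟨,⟩-zero (⊥ {m}) (f ∘ suc) (⊥-elim ∘ ∉⊥))) (Bool.xor-identityʳ (f zero))
⟨,⟩-singleton (suc x) f = ⟨,⟩-singleton x (f ∘ suc)

∣∩∁∣+∣∩∣ : (p q : Subset m) → ∣ p ∩ ∁ q ∣ + ∣ p ∩ q ∣ ≡ ∣ p ∣
∣∩∁∣+∣∩∣ []          []          = refl
∣∩∁∣+∣∩∣ (false ∷ p) (_     ∷ q) = ∣∩∁∣+∣∩∣ p q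
∣∩∁∣+∣∩∣ (true  ∷ p) (false ∷ q) = cong suc (∣∩∁∣+∣∩∣ p q)
∣∩∁∣+∣∩∣ (true  ∷ p) (true  ∷ q) = trans (+-suc _ _) (cong suc (∣∩∁∣+∣∩∣ p q))

∣∩∣+∣∪∣ : (p q : Subset m) → ∣ p ∩ q ∣ + ∣ p ∪ q ∣ ≡ ∣ p ∣ + ∣ q ∣
∣∩∣+∣∪∣ []          []          = refl
∣∩∣+∣∪∣ (false ∷ p) (false ∷ q) = ∣∩∣+∣∪∣ p q
∣∩∣+∣∪∣ (false ∷ p) (true  ∷ q) = trans (+-suc _ _) (trans (cong suc (∣∩∣+∣∪∣ p q)) (sym (+-suc _ _)))
∣∩∣+∣∪∣ (true  ∷ p) (false ∷ q) = trans (+-suc _ _) (cong suc (∣∩∣+∣∪∣ p q))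
∣∩∣+∣∪∣ (true  ∷ p) (true  ∷ q) = cong suc (trans (+-suc _ _) (trans (cong suc (∣∩∣+∣∪∣ p q)) (sym (+-suc _ _))))

-- Row dependencies and rank-nullity

kernel : Matrix m n → Subset m → Subset n → Subspace m
kernel M X Y = record
  { _∋_ = λ c → c ⊆ X × (∀ j → j ∈ Y → combination M c j ≡ false)
  ; ∋?  = λ c → c ⊆? X ×-dec Fin.all? (λ j → j ∈? Y →-dec combination M c j Bool.≟ false)
  ; ∋-⊥ = ⊥⊆ , λ j _ → ⟨,⟩-zero ⊥ (λ i → M i j) (⊥-elim ∘ ∉⊥)
  ; ∋-⊕ = λ { {c} {d} (c⊆ , c0) (d⊆ , d0) → ⊕-⊆ c⊆ d⊆ ,
      λ j j∈ → trans (⟨,⟩-⊕ c d (λ i → M i j)) (cong₂ _xor_ (c0 j j∈) (d0 j j∈)) }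
  }

∈-subsets : (p : Subset n) → p ∈ₗ subsets n
∈-subsets []          = here refl
∈-subsets (false ∷ p) = ∈-++⁺ˡ (∈-map⁺ _ (∈-subsets p))
∈-subsets (true  ∷ p) = ∈-++⁺ʳ _ (∈-map⁺ _ (∈-subsets p))

module _ (M : Matrix m n) (X : Subset m) (Y : Subset n) where

  private
    -- Repeats the local definition inside `rank`, so that `rank M X Y` unfolds to `max 0 sizes`.
    admissible? : (I : Subset m) → Dec (I ⊆ X × Independent M Y I)
    admissible? I = I ⊆? X ×-dec independent? M Y I

    sizes : List ℕ
    sizes = map ∣_∣ (filter admissible? (subsets m))

  independent⇒≤rank : ∀ {I} → I ⊆ X → Independent M Y I → ∣ I ∣ ≤ rank M X Y
  independent⇒≤rank {I} I⊆X ind = All.lookup (xs≤max 0 sizes)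
    (∈-map⁺ ∣_∣ (∈-filter⁺ admissible? (∈-subsets I) (I⊆X , ind)))

  rank≤ : ∀ {r} → (∀ I → I ⊆ X → Independent M Y I → ∣ I ∣ ≤ r) → rank M X Y ≤ r
  rank≤ {r} bound = max≤v⁺ {xs = sizes} z≤n (All.tabulate λ s∈ →
    let (I , I∈ , s≡) = ∈-map⁻ ∣_∣ s∈
        (I⊆X , ind) = proj₂ (∈-filter⁻ admissible? {xs = subsets m} I∈)
    in ≤-trans (≤-reflexive s≡) (bound I I⊆X ind))

  private
    K = kernel M X Y
    P = pivots K

    P⊆X : P ⊆ X
    P⊆X = pivots-⊆ K proj₁

  -- A kernel vector led by a pivot expresses that row through later rows, so the rows of `X` that
  -- are not pivots form a row basis.
  basis : Subset m
  basis = X ∩ ∁ P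

  basis⊆ : basis ⊆ X
  basis⊆ = p∩q⊆p X (∁ P)

  basis-independent : Independent M Y basis
  basis-independent (c , c⊆ , nonempty , c0) =
    pivot-free K ((λ x∈ → basis⊆ (c⊆ x∈)) , c0)
      (λ x∈P x∈c → x∈p⇒x∉∁p x∈P (p∩q⊆q X (∁ P) (c⊆ x∈c)))
      nonempty

  ∣basis∣+dim : ∣ basis ∣ + dim K ≡ ∣ X ∣
  ∣basis∣+dim = trans (cong (∣ basis ∣ +_) (cong ∣_∣ (⊆-antisym
      (λ x∈P → x∈p∩q⁺ (P⊆X x∈P , x∈P)) (p∩q⊆q X P))))
    (∣∩∁∣+∣∩∣ X P)

  -- Rank-nullity. `basis` gives one bound; for the other, the vectors supported on an independent
  -- set meet the kernel only in zero, and modularity of dimension limits the size of that set.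
  rank+dim : rank M X Y + dim K ≡ ∣ X ∣
  rank+dim = ≤-antisym upper lower
    where
    lower : ∣ X ∣ ≤ rank M X Y + dim K
    lower = ≤-trans (≤-reflexive (sym ∣basis∣+dim))
      (+-monoˡ-≤ (dim K) (independent⇒≤rank basis⊆ basis-independent))

    bound : ∀ I → I ⊆ X → Independent M Y I → ∣ I ∣ + dim K ≤ ∣ X ∣
    bound I I⊆X ind = begin
      ∣ I ∣ + dim K                     ≤⟨ +-monoˡ-≤ (dim K) (dim-powerSpace-≥ I) ⟩
      dim (powerSpace I) + dim K        ≤⟨ dim-modular (powerSpace I) K J (powerSpace X)
                                             (λ c⊆I c∈K → c⊆I , proj₂ c∈K)
                                             (λ c⊆I → ⊆-trans c⊆I I⊆X) proj₁ ⟩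
      dim J + dim (powerSpace X)        ≡⟨ cong (_+ dim (powerSpace X)) (dim-zero J
                                             (λ (c⊆I , c0) nonempty → ind (_ , c⊆I , nonempty , c0))) ⟩
      dim (powerSpace X)                ≤⟨ dim-powerSpace-≤ X ⟩
      ∣ X ∣                             ∎
      where
      open ≤-Reasoning
      J = kernel M I Y

    upper : rank M X Y + dim K ≤ ∣ X ∣
    upper = ≤-trans (+-monoˡ-≤ (dim K) (rank≤ {∣ X ∣ ∸ dim K} (λ I I⊆X ind →
        m+n≤o⇒m≤o∸n ∣ I ∣ (bound I I⊆X ind))))
      (≤-reflexive (m∸n+n≡m (p⊆q⇒∣p∣≤∣q∣ P⊆X)))

-- Each row is, modulo the kernel, congruent to a combination of basis rows.
basis-spans : (M : Matrix m n) (X : Subset m) (Y : Subset n) {d : Subset n} → d ⊆ Y →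
              (∀ i → i ∈ basis M X Y → combination (flip M) d i ≡ false) →
              ∀ i → i ∈ X → combination (flip M) d i ≡ false
basis-spans M X Y {d} d⊆Y d0 i i∈X with reduce (kernel M X Y) ⁅ i ⁆
... | k , (k⊆X , k0) , free = begin
  combination (flip M) d i                ≡⟨ ⟨,⟩-cong d (λ {j} j∈d → sym (begin
      combination M c j                       ≡⟨ ⟨,⟩-⊕ ⁅ i ⁆ k (λ i → M i j) ⟩
      combination M ⁅ i ⁆ j xor combination M k j
                                              ≡⟨ cong₂ _xor_ (⟨,⟩-singleton i (λ i → M i j)) (k0 j (d⊆Y j∈d)) ⟩
      M i j xor false                         ≡⟨ Bool.xor-identityʳ (M i j) ⟩
      M i j                                   ∎)) ⟩
  ⟨ d , combination M c ⟩                 ≡⟨ ⟨,⟩-swap c d M ⟩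
  ⟨ c , combination (flip M) d ⟩          ≡⟨ ⟨,⟩-zero c (combination (flip M) d) (λ {x} x∈c → d0 x (x∈p∩q⁺
                                               (c⊆X x∈c , x∉p⇒x∈∁p (λ x∈P → free x∈P x∈c)))) ⟩
  false                                   ∎
  where
  open ≡-Reasoning
  c = ⁅ i ⁆ ⊕ k
  c⊆X : c ⊆ X
  c⊆X = ⊕-⊆ (λ x∈ → subst (_∈ X) (sym (x∈⁅y⁆⇒x≡y i x∈)) i∈X) k⊆X

-- By rank-nullity, over a fixed set of rows a larger kernel means a smaller rank. The two matrices
-- may have different columns.
rank-mono-kernel : {n′ : ℕ} {M : Matrix m n} {M′ : Matrix m n′} {X : Subset m} {Y : Subset n} {Y′ : Subset n′} →
                   (∀ {c} → c ⊆ X → (∀ j → j ∈ Y → combination M c j ≡ false) →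
                                    (∀ j → j ∈ Y′ → combination M′ c j ≡ false)) →
                   rank M′ X Y′ ≤ rank M X Y
rank-mono-kernel {M = M} {M′} {X} {Y} {Y′} K≤K′ = +-cancelʳ-≤ (dim (kernel M X Y)) _ _ (begin
  rank M′ X Y′ + dim (kernel M X Y)    ≤⟨ +-monoʳ-≤ (rank M′ X Y′)
    (dim-mono (kernel M X Y) (kernel M′ X Y′) (λ (c⊆ , c0) → c⊆ , K≤K′ c⊆ c0)) ⟩
  rank M′ X Y′ + dim (kernel M′ X Y′)  ≡⟨ rank+dim M′ X Y′ ⟩
  ∣ X ∣                                ≡⟨ rank+dim M X Y ⟨
  rank M X Y + dim (kernel M X Y)      ∎)
  where open ≤-Reasoning

-- Every column of `Y` imposes one linear condition on the vectors supported on `X`.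
rank≤∣columns∣ : (M : Matrix m n) (X : Subset m) (Y : Subset n) → rank M X Y ≤ ∣ Y ∣
rank≤∣columns∣ M X Y = +-cancelʳ-≤ (dim (kernel M X Y)) _ _ (begin
  rank M X Y + dim (kernel M X Y)  ≡⟨ rank+dim M X Y ⟩
  ∣ X ∣                            ≤⟨ dim-powerSpace-≥ X ⟩
  dim (powerSpace X)               ≤⟨ codim M Y ⟩
  ∣ Y ∣ + dim (kernel M X Y)       ∎)
  where
  open ≤-Reasoning
  codim : ∀ {n} (M : Matrix _ n) (Y : Subset n) → dim (powerSpace X) ≤ ∣ Y ∣ + dim (kernel M X Y)
  codim M [] = dim-mono (powerSpace X) (kernel M X []) (λ c⊆ → c⊆ , λ ())
  codim M (false ∷ Y) = ≤-trans (codim (λ i j → M i (suc j)) Y) (+-monoʳ-≤ ∣ Y ∣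
    (dim-mono (kernel (λ i j → M i (suc j)) X Y) (kernel M X (false ∷ Y))
      (λ (c⊆ , c0) → c⊆ , λ { (suc j) (there j∈) → c0 j j∈ })))
  codim M (true ∷ Y) = ≤-trans (codim (λ i j → M i (suc j)) Y) (≤-trans (+-monoʳ-≤ ∣ Y ∣
    (dim-hyperplane (kernel (λ i j → M i (suc j)) X Y) (kernel M X (true ∷ Y))
      (λ c → combination M c zero) (λ c d → ⟨,⟩-⊕ c d (λ i → M i zero))
      (λ (c⊆ , c0) z → c⊆ , λ { zero here → z ; (suc j) (there j∈) → c0 j j∈ })))
    (≤-reflexive (+-suc ∣ Y ∣ _)))

-- A column dependency on the basis rows holds on all rows of `X`, so the column rank is already
-- reached on the basis rows and is at most their number.
rank-flip-≤ : (M : Matrix m n) (X : Subset m) (Y : Subset n) → rank (flip M) Y X ≤ rank M X Y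
rank-flip-≤ M X Y = begin
  rank (flip M) Y X               ≤⟨ rank-mono-kernel (basis-spans M X Y) ⟩
  rank (flip M) Y (basis M X Y)   ≤⟨ rank≤∣columns∣ (flip M) Y (basis M X Y) ⟩
  ∣ basis M X Y ∣                 ≤⟨ independent⇒≤rank M X Y (basis⊆ M X Y) (basis-independent M X Y) ⟩
  rank M X Y                      ∎
  where open ≤-Reasoning

rank-flip : (M : Matrix m n) (X : Subset m) (Y : Subset n) → rank (flip M) Y X ≡ rank M X Y
rank-flip M X Y = ≤-antisym (rank-flip-≤ M X Y) (rank-flip-≤ (flip M) Y X)

rank-mono-cokernel : {m′ : ℕ} {M : Matrix m n} {M′ : Matrix m′ n} {X : Subset m} {X′ : Subset m′} {Y : Subset n} →
                     (∀ {d} → d ⊆ Y → (∀ i → i ∈ X → ⟨ d , M i ⟩ ≡ false) →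
                                      (∀ i → i ∈ X′ → ⟨ d , M′ i ⟩ ≡ false)) →
                     rank M′ X′ Y ≤ rank M X Y
rank-mono-cokernel {M = M} {M′} {X} {X′} {Y} L≤L′ = begin
  rank M′ X′ Y          ≡⟨ rank-flip M′ X′ Y ⟨
  rank (flip M′) Y X′   ≤⟨ rank-mono-kernel L≤L′ ⟩
  rank (flip M) Y X     ≡⟨ rank-flip M X Y ⟩
  rank M X Y            ∎
  where open ≤-Reasoning

rank-mono : {M M′ : Matrix m n} {X X′ : Subset m} {Y Y′ : Subset n} → X ⊆ X′ → Y ⊆ Y′ →
            (∀ i j → i ∈ X → j ∈ Y → M i j ≡ M′ i j) → rank M X Y ≤ rank M′ X′ Y′
rank-mono {M = M} {M′} {X} {X′} {Y} {Y′} X⊆ Y⊆ M≡M′ = ≤-trans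
  (rank-mono-kernel {M = M′} {X = X} {Y = Y′} (λ {c} c⊆ c0 j j∈ →
    trans (⟨,⟩-cong c (λ i∈ → M≡M′ _ j (c⊆ i∈) j∈)) (c0 j (Y⊆ j∈))))
  (rank-mono-cokernel {M = M′} {M′} {X = X′} (λ d⊆ d0 i i∈ → d0 i (X⊆ i∈)))

-- The kernels for the two submatrices intersect inside the kernel for `X₁ ∩ X₂` and both lie in the
-- kernel for `X₁ ∪ X₂`. Nullity is therefore supermodular, while the number of rows is modular.
rank-submodular : (M : Matrix m n) (X₁ X₂ : Subset m) (Y₁ Y₂ : Subset n) →
                  rank M (X₁ ∩ X₂) (Y₁ ∪ Y₂) + rank M (X₁ ∪ X₂) (Y₁ ∩ Y₂)
                  ≤ rank M X₁ Y₁ + rank M X₂ Y₂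
rank-submodular M X₁ X₂ Y₁ Y₂ = +-cancelʳ-≤ (k₁ + k₂) _ _ (begin
  (rᵢ + rᵤ) + (k₁ + k₂)      ≤⟨ +-monoʳ-≤ (rᵢ + rᵤ) (dim-modular K₁ K₂ Kᵢ Kᵤ meet join₁ join₂) ⟩
  (rᵢ + rᵤ) + (kᵢ + kᵤ)      ≡⟨ interchange rᵢ rᵤ kᵢ kᵤ ⟩
  (rᵢ + kᵢ) + (rᵤ + kᵤ)      ≡⟨ cong₂ _+_ (rank+dim M _ _) (rank+dim M _ _) ⟩
  ∣ X₁ ∩ X₂ ∣ + ∣ X₁ ∪ X₂ ∣  ≡⟨ ∣∩∣+∣∪∣ X₁ X₂ ⟩
  ∣ X₁ ∣ + ∣ X₂ ∣            ≡⟨ cong₂ _+_ (rank+dim M _ _) (rank+dim M _ _) ⟨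
  (r₁ + k₁) + (r₂ + k₂)      ≡⟨ interchange r₁ k₁ r₂ k₂ ⟩
  (r₁ + r₂) + (k₁ + k₂)      ∎)
  where
  open ≤-Reasoning
  r₁ = rank M X₁ Y₁
  r₂ = rank M X₂ Y₂
  rᵢ = rank M (X₁ ∩ X₂) (Y₁ ∪ Y₂)
  rᵤ = rank M (X₁ ∪ X₂) (Y₁ ∩ Y₂)
  K₁ = kernel M X₁ Y₁
  K₂ = kernel M X₂ Y₂
  Kᵢ = kernel M (X₁ ∩ X₂) (Y₁ ∪ Y₂)
  Kᵤ = kernel M (X₁ ∪ X₂) (Y₁ ∩ Y₂)
  k₁ = dim K₁
  k₂ = dim K₂
  kᵢ = dim Kᵢ
  kᵤ = dim Kᵤ

  meet : ∀ {c} → K₁ ∋ c → K₂ ∋ c → Kᵢ ∋ c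
  meet (c⊆₁ , c0₁) (c⊆₂ , c0₂) =
    (λ x∈ → x∈p∩q⁺ (c⊆₁ x∈ , c⊆₂ x∈)) , λ j j∈ → [ c0₁ j , c0₂ j ]′ (x∈p∪q⁻ Y₁ Y₂ j∈)

  join₁ : K₁ ≤ˢ Kᵤ
  join₁ (c⊆ , c0) = (λ x∈ → p⊆p∪q X₂ (c⊆ x∈)) , λ j j∈ → c0 j (p∩q⊆p Y₁ Y₂ j∈)

  join₂ : K₂ ≤ˢ Kᵤ
  join₂ (c⊆ , c0) = (λ x∈ → q⊆p∪q X₁ X₂ (c⊆ x∈)) , λ j j∈ → c0 j (p∩q⊆q Y₁ Y₂ j∈)

-- On kernel vectors `c` of `M′` with `⟨ c , f ⟩` false the rank-one term contributes nothing, so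
-- they lie in the kernel of `M`.
rank-rankOne : (M M′ : Matrix m n) {X : Subset m} {Y : Subset n} (f : Fin m → Bool) (g : Fin n → Bool) →
               (∀ i j → i ∈ X → j ∈ Y → M i j ≡ M′ i j xor (f i ∧ g j)) →
               rank M X Y ≤ suc (rank M′ X Y)
rank-rankOne M M′ {X} {Y} f g M≡ = +-cancelʳ-≤ (dim (kernel M X Y)) _ _ (begin
  rank M X Y + dim (kernel M X Y)       ≡⟨ rank+dim M X Y ⟩
  ∣ X ∣                                 ≡⟨ rank+dim M′ X Y ⟨
  rank M′ X Y + dim (kernel M′ X Y)     ≤⟨ +-monoʳ-≤ (rank M′ X Y)
    (dim-hyperplane (kernel M′ X Y) (kernel M X Y) (λ c → ⟨ c , f ⟩) (λ c d → ⟨,⟩-⊕ c d f)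
      (λ {c} (c⊆ , c0) φ0 → c⊆ , λ j j∈ → trans
        (⟨,⟩-cong c (λ i∈ → M≡ _ j (c⊆ i∈) j∈)) (trans
        (⟨,⟩-xor c (λ i → M′ i j) (λ i → f i ∧ g j))
        (cong₂ _xor_ (c0 j j∈) (trans (⟨,⟩-∧ c f (g j)) (cong (_∧ g j) φ0)))))) ⟩
  rank M′ X Y + suc (dim (kernel M X Y)) ≡⟨ +-suc _ _ ⟩
  suc (rank M′ X Y) + dim (kernel M X Y) ∎)
  where open ≤-Reasoning

-- The rows of `M′` lie in the row space of `M`. Row `u` is cancelled if `f u` is true, hence only
-- an inequality.
rank-addRow : (M M′ : Matrix m n) {X : Subset m} {Y : Subset n} (f : Fin m → Bool) {u : Fin m} → u ∈ X →
              (∀ i j → i ∈ X → j ∈ Y → M′ i j ≡ M i j xor (f i ∧ M u j)) →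
              rank M′ X Y ≤ rank M X Y
rank-addRow M M′ f {u} u∈ M′≡ = rank-mono-cokernel {M = M} (λ {d} d⊆ d0 i i∈ → trans
  (⟨,⟩-cong d (λ j∈ → M′≡ i _ i∈ (d⊆ j∈))) (trans
  (⟨,⟩-xor d (M i) (λ j → f i ∧ M u j))
  (cong₂ _xor_ (d0 i i∈) (trans
    (⟨,⟩-cong d (λ {j} _ → Bool.∧-comm (f i) (M u j)))
    (trans (⟨,⟩-∧ d (M u) (f i)) (cong (_∧ f i) (d0 u u∈)))))))

rank-addColumn : (M M′ : Matrix m n) {X : Subset m} {Y : Subset n} (g : Fin n → Bool) {u : Fin n} → u ∈ Y →
                 (∀ i j → i ∈ X → j ∈ Y → M′ i j ≡ M i j xor (M i u ∧ g j)) →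
                 rank M′ X Y ≤ rank M X Y
rank-addColumn M M′ g {u} u∈ M′≡ = rank-mono-kernel {M = M} (λ {c} c⊆ c0 j j∈ → trans
  (⟨,⟩-cong c (λ i∈ → M′≡ _ j (c⊆ i∈) j∈)) (trans
  (⟨,⟩-xor c (λ i → M i j) (λ i → M i u ∧ g j))
  (cong₂ _xor_ (c0 j j∈) (trans (⟨,⟩-∧ c (λ i → M i u) (g j)) (cong (_∧ g j) (c0 u u∈))))))

-- Cut-rank of a symmetric matrix

module _ {n : ℕ} where
  open BooleanAlgebraProperties (∪-∩-booleanAlgebra n) public
    using () renaming (deMorgan₁ to ∁-∩; deMorgan₂ to ∁-∪; ¬-involutive to ∁-involutive)

infixl 7 _◂_

_◂_ : Subset n → Fin n → Subset n
X ◂ v = X ∪ ⁅ v ⁆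

module _ {X : Subset n} {v : Fin n} where

  ∈-◂⁻ : ∀ {x} → x ∈ X ◂ v → x ∈ X ⊎ x ≡ v
  ∈-◂⁻ = Sum.map₂ (x∈⁅y⁆⇒x≡y v) ∘ x∈p∪q⁻ X ⁅ v ⁆

  ∈-◂ˡ : X ⊆ X ◂ v
  ∈-◂ˡ = p⊆p∪q ⁅ v ⁆

  ∈-◂ʳ : v ∈ X ◂ v
  ∈-◂ʳ = x∈p∪q⁺ (inj₂ (x∈⁅x⁆ v))

  ∉-◂ : ∀ {x} → x ∉ X → x ≢ v → x ∉ X ◂ v
  ∉-◂ x∉X x≢v = [ x∉X , x≢v ]′ ∘ ∈-◂⁻

  ◂-⊆ : {Y : Subset n} → X ⊆ Y → v ∈ Y → X ◂ v ⊆ Y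
  ◂-⊆ X⊆Y v∈Y x∈ = [ X⊆Y , (λ { refl → v∈Y }) ]′ (∈-◂⁻ x∈)

  ◂-elim : ∀ {x} → x ∈ X ◂ v → x ≢ v → x ∈ X
  ◂-elim x∈ x≢v = [ id , (λ x≡v → contradiction x≡v x≢v) ]′ (∈-◂⁻ x∈)

◂-mono : {X Y : Subset n} {v : Fin n} → X ⊆ Y → X ◂ v ⊆ Y ◂ v
◂-mono X⊆Y = ◂-⊆ (∈-◂ˡ ∘ X⊆Y) ∈-◂ʳ

∁-◂-◂ : {X : Subset n} {v : Fin n} → v ∉ X → ∁ (X ◂ v) ◂ v ≡ ∁ X
∁-◂-◂ {X = X} {v} v∉X = ⊆-antisym (◂-⊆ (p⊆q⇒∁p⊇∁q ∈-◂ˡ) (x∉p⇒x∈∁p v∉X)) back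
  where
  back : ∁ X ⊆ ∁ (X ◂ v) ◂ v
  back {x} x∈ with x ≟ v
  ... | yes refl = ∈-◂ʳ
  ... | no x≢v   = ∈-◂ˡ (x∉p⇒x∈∁p (∉-◂ (x∈∁p⇒x∉p x∈) x≢v))

rank-addOneRow : (M : Matrix m n) (X : Subset m) (v : Fin m) (Y : Subset n) →
                 rank M (X ◂ v) Y ≤ suc (rank M X Y)
rank-addOneRow M X v Y = begin
  rank M (X ◂ v) Y                                           ≤⟨ m≤n+m _ _ ⟩
  rank M (X ∩ ⁅ v ⁆) (Y ∪ Y) + rank M (X ◂ v) Y              ≤⟨ +-monoʳ-≤ (rank M (X ∩ ⁅ v ⁆) (Y ∪ Y))
      (rank-mono {M = M} ⊆-refl (λ y → x∈p∩q⁺ (y , y)) (λ _ _ _ _ → refl)) ⟩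
  rank M (X ∩ ⁅ v ⁆) (Y ∪ Y) + rank M (X ◂ v) (Y ∩ Y)        ≤⟨ rank-submodular M X ⁅ v ⁆ Y Y ⟩
  rank M X Y + rank M ⁅ v ⁆ Y                                ≤⟨ +-monoʳ-≤ (rank M X Y) (m+n≤o⇒m≤o _ (≤-reflexive
      (trans (rank+dim M ⁅ v ⁆ Y) (∣⁅x⁆∣≡1 v)))) ⟩
  rank M X Y + 1                                             ≡⟨ +-comm _ 1 ⟩
  suc (rank M X Y)                                           ∎
  where open ≤-Reasoning

-- For `v ∉ X`, the sets `X` and `∁ (X ◂ v)` partition the ground set without `v`.
OneSide : Fin n → Subset n → Subset n → Set
OneSide v Z X = Z ⊆ X ⊎ Z ⊆ ∁ (X ◂ v)

data Removal : Set where
  delete contract : Removal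

-- For v ∉ X, τ o v X is one more than the cut-rank of X after the removal of v
-- by deletion, or by pivoting on an edge at v and then deleting v.
record RemovalSystem (n : ℕ) : Set where
  field
    ρ                 : Subset n → ℕ
    ρ-⊥               : ρ ⊥ ≡ 0
    ρ-compl           : ∀ X → ρ (∁ X) ≡ ρ X
    ρ-submodular      : ∀ X Y → ρ (X ∩ Y) + ρ (X ∪ Y) ≤ ρ X + ρ Y
    τ                 : Removal → Fin n → Subset n → ℕ
    ρ≤τ               : ∀ o v {X} → v ∉ X → ρ X ≤ τ o v X
    ρ◂≤τ              : ∀ o v X → ρ (X ◂ v) ≤ τ o v X
    τ-down            : ∀ o {v X Z} → v ∉ X → Z ⊆ X → ρ (X ◂ v) + τ o v Z ≤ ρ (Z ◂ v) + τ o v X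
    τ-up              : ∀ o {v X W} → v ∉ W → X ⊆ W → ρ X + τ o v W ≤ ρ W + τ o v X
    τ-compl           : ∀ o {v Z} → v ∉ Z → τ o v Z ≡ τ o v (∁ (Z ◂ v))
    τ-delete-contract : ∀ v Z → ρ Z + ρ (Z ◂ v) < τ delete v Z + τ contract v Z

-- The removal system of a symmetric matrix

module SymmetricMatrix {n : ℕ} (A : Matrix n n) (A-sym : ∀ x y → A x y ≡ A y x) where

  -- Columns are named by their complement, so that `R X X` is the cut-rank and submodularity takes
  -- intersections in both arguments or unions in both.
  R : Subset n → Subset n → ℕ
  R X Y = rank A X (∁ Y)

  ρ : Subset n → ℕ
  ρ X = R X X

  R-mono : ∀ {X X′ Y Y′} → X ⊆ X′ → Y′ ⊆ Y → R X Y ≤ R X′ Y′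
  R-mono X⊆X′ Y′⊆Y = rank-mono {M = A} X⊆X′ (p⊆q⇒∁p⊇∁q Y′⊆Y) (λ _ _ _ _ → refl)

  R-compl : ∀ X Y → R X Y ≡ R (∁ Y) (∁ X)
  R-compl X Y = begin
    rank A X (∁ Y)              ≡⟨ rank-flip A X (∁ Y) ⟨
    rank (flip A) (∁ Y) X       ≡⟨ ≤-antisym (rank-mono ⊆-refl ⊆-refl (λ i j _ _ → A-sym j i))
                                             (rank-mono ⊆-refl ⊆-refl (λ i j _ _ → A-sym i j)) ⟩
    rank A (∁ Y) X              ≡⟨ cong (rank A (∁ Y)) (∁-involutive X) ⟨
    rank A (∁ Y) (∁ (∁ X))      ∎
    where open ≡-Reasoning

  ρ-compl : ∀ X → ρ (∁ X) ≡ ρ X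
  ρ-compl X = sym (R-compl X X)

  -- `R` grows with its first argument and shrinks with its second, so inclusions replace exact
  -- intersections and unions; the instances below then need no set identities.
  R-submodular : ∀ {I J U W X₁ Y₁ X₂ Y₂} →
                 I ⊆ X₁ → I ⊆ X₂ → (∀ {x} → x ∈ Y₁ → x ∈ Y₂ → x ∈ J) →
                 (∀ {x} → x ∈ U → x ∈ X₁ ⊎ x ∈ X₂) → Y₁ ⊆ W → Y₂ ⊆ W →
                 R I J + R U W ≤ R X₁ Y₁ + R X₂ Y₂
  R-submodular {I} {J} {U} {W} {X₁} {Y₁} {X₂} {Y₂} I⊆₁ I⊆₂ ∩⊆J U⊆∪ ⊆W₁ ⊆W₂ = begin
    R I J + R U W
      ≤⟨ +-mono-≤
           (R-mono {X′ = X₁ ∩ X₂} {Y′ = Y₁ ∩ Y₂} (λ x∈ → x∈p∩q⁺ (I⊆₁ x∈ , I⊆₂ x∈))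
             (λ y∈ → let (y₁ , y₂) = x∈p∩q⁻ Y₁ Y₂ y∈ in ∩⊆J y₁ y₂))
           (R-mono {X′ = X₁ ∪ X₂} {Y′ = Y₁ ∪ Y₂} (λ x∈ → x∈p∪q⁺ (U⊆∪ x∈))
             (λ y∈ → [ ⊆W₁ , ⊆W₂ ]′ (x∈p∪q⁻ Y₁ Y₂ y∈))) ⟩
    R (X₁ ∩ X₂) (Y₁ ∩ Y₂) + R (X₁ ∪ X₂) (Y₁ ∪ Y₂)
      ≡⟨ cong₂ _+_ (cong (rank A (X₁ ∩ X₂)) (∁-∩ Y₁ Y₂)) (cong (rank A (X₁ ∪ X₂)) (∁-∪ Y₁ Y₂)) ⟩
    rank A (X₁ ∩ X₂) (∁ Y₁ ∪ ∁ Y₂) + rank A (X₁ ∪ X₂) (∁ Y₁ ∩ ∁ Y₂)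
      ≤⟨ rank-submodular A X₁ X₂ (∁ Y₁) (∁ Y₂) ⟩
    R X₁ Y₁ + R X₂ Y₂ ∎
    where open ≤-Reasoning

  ρ-submodular : ∀ X Y → ρ (X ∩ Y) + ρ (X ∪ Y) ≤ ρ X + ρ Y
  ρ-submodular X Y = R-submodular (p∩q⊆p X Y) (p∩q⊆q X Y) (λ x y → x∈p∩q⁺ (x , y))
    (x∈p∪q⁻ X Y) (p⊆p∪q Y) (q⊆p∪q X Y)

  ρ-⊥ : ρ ⊥ ≡ 0
  ρ-⊥ = n≤0⇒n≡0 (≤-trans (m+n≤o⇒m≤o _ (≤-reflexive (rank+dim A ⊥ (∁ ⊥)))) (≤-reflexive (∣⊥∣≡0 n)))

  -- Deletion drops `v` as row and column. For `contract`, `v` is both a row and a column, which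
  -- pivoting on an edge at `v` eliminates at the cost of at most one in rank.
  τ : Removal → Fin n → Subset n → ℕ
  τ delete   v X = suc (R X (X ◂ v))
  τ contract v X = R (X ◂ v) X

  ρ≤τ : ∀ o v {X} → v ∉ X → ρ X ≤ τ o v X
  ρ≤τ delete v {X} v∉X = begin
    -- Transposing turns the missing column `v` into a missing row.
    R X X                       ≡⟨ R-compl X X ⟩
    R (∁ X) (∁ X)               ≡⟨ cong (λ Y → R Y (∁ X)) (∁-◂-◂ v∉X) ⟨
    R (∁ (X ◂ v) ◂ v) (∁ X)     ≤⟨ rank-addOneRow A (∁ (X ◂ v)) v (∁ (∁ X)) ⟩
    suc (R (∁ (X ◂ v)) (∁ X))   ≡⟨ cong suc (R-compl X (X ◂ v)) ⟨
    suc (R X (X ◂ v))           ∎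
    where open ≤-Reasoning
  ρ≤τ contract v _ = R-mono ∈-◂ˡ ⊆-refl

  ρ◂≤τ : ∀ o v X → ρ (X ◂ v) ≤ τ o v X
  ρ◂≤τ delete   v X = rank-addOneRow A X v (∁ (X ◂ v))
  ρ◂≤τ contract v X = R-mono ⊆-refl ∈-◂ˡ

  -- The excess of `τ o v X` over `ρ (X ◂ v)` does not decrease as `X` grows, by submodularity of
  -- `R`.
  τ-down : ∀ o {v X Z} → v ∉ X → Z ⊆ X → ρ (X ◂ v) + τ o v Z ≤ ρ (Z ◂ v) + τ o v X
  τ-down delete {v} {X} {Z} v∉X Z⊆X = begin
    ρ (X ◂ v) + suc (R Z (Z ◂ v))  ≡⟨ +-suc _ _ ⟩
    suc (ρ (X ◂ v) + R Z (Z ◂ v))  ≡⟨ cong suc (+-comm (ρ (X ◂ v)) _) ⟩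
    suc (R Z (Z ◂ v) + ρ (X ◂ v))  ≤⟨ s≤s (R-submodular ∈-◂ˡ Z⊆X (λ x _ → x)
                                        (Sum.swap ∘ Sum.map₂ (λ { refl → ∈-◂ʳ }) ∘ ∈-◂⁻)
                                        (◂-mono Z⊆X) ⊆-refl) ⟩
    suc (ρ (Z ◂ v) + R X (X ◂ v))  ≡⟨ +-suc _ _ ⟨
    ρ (Z ◂ v) + suc (R X (X ◂ v))  ∎
    where open ≤-Reasoning
  τ-down contract {v} {X} {Z} v∉X Z⊆X = begin
    ρ (X ◂ v) + R (Z ◂ v) Z        ≡⟨ +-comm (ρ (X ◂ v)) _ ⟩
    R (Z ◂ v) Z + ρ (X ◂ v)        ≤⟨ R-submodular ⊆-refl (◂-mono Z⊆X)
                                        (λ x∈Z◂v x∈X → ◂-elim x∈Z◂v λ { refl → v∉X x∈X })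
                                        inj₂ (◂-mono Z⊆X) ∈-◂ˡ ⟩
    ρ (Z ◂ v) + R (X ◂ v) X        ∎
    where open ≤-Reasoning

  -- Dually, the excess of `τ o v X` over `ρ X` does not increase as `X` grows.
  τ-up : ∀ o {v X W} → v ∉ W → X ⊆ W → ρ X + τ o v W ≤ ρ W + τ o v X
  τ-up delete {v} {X} {W} v∉W X⊆W = begin
    ρ X + suc (R W (W ◂ v))  ≡⟨ +-suc _ _ ⟩
    suc (ρ X + R W (W ◂ v))  ≤⟨ s≤s (R-submodular X⊆W ⊆-refl
                                  (λ x∈W x∈X◂v → ◂-elim x∈X◂v λ { refl → v∉W x∈W })
                                  inj₁ ∈-◂ˡ (◂-mono X⊆W)) ⟩
    suc (ρ W + R X (X ◂ v))  ≡⟨ +-suc _ _ ⟨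
    ρ W + suc (R X (X ◂ v))  ∎
    where open ≤-Reasoning
  τ-up contract {v} {X} {W} v∉W X⊆W =
    R-submodular X⊆W ∈-◂ˡ (λ _ x → x) (Sum.map₂ (λ { refl → ∈-◂ʳ }) ∘ ∈-◂⁻) ⊆-refl X⊆W

  -- Submodularity of `R` gives the weak inequality with `R Z (Z ◂ v)`; the `suc` in `τ delete`
  -- makes it strict.
  τ-delete-contract : ∀ v Z → ρ Z + ρ (Z ◂ v) < τ delete v Z + τ contract v Z
  τ-delete-contract v Z = s≤s (R-submodular ⊆-refl ∈-◂ˡ (λ _ x → x) inj₂ ⊆-refl ∈-◂ˡ)

  τ-compl : ∀ o {v Z} → v ∉ Z → τ o v Z ≡ τ o v (∁ (Z ◂ v))
  τ-compl delete {v} {Z} v∉Z = cong suc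
    (trans (R-compl Z (Z ◂ v)) (cong (R (∁ (Z ◂ v))) (sym (∁-◂-◂ v∉Z))))
  τ-compl contract {v} {Z} v∉Z =
    trans (R-compl (Z ◂ v) Z) (cong (λ Y → R Y (∁ (Z ◂ v))) (sym (∁-◂-◂ v∉Z)))

  removalSystem : RemovalSystem n
  removalSystem = record
    { ρ = ρ ; ρ-⊥ = ρ-⊥ ; ρ-compl = ρ-compl ; ρ-submodular = ρ-submodular
    ; τ = τ ; ρ≤τ = ρ≤τ ; ρ◂≤τ = ρ◂≤τ ; τ-down = τ-down ; τ-up = τ-up
    ; τ-compl = τ-compl ; τ-delete-contract = τ-delete-contract }

-- Separations

∣◂∣≤ : (X : Subset n) (v : Fin n) → ∣ X ◂ v ∣ ≤ suc ∣ X ∣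
∣◂∣≤ X v = begin
  ∣ X ◂ v ∣                      ≤⟨ m≤n+m _ _ ⟩
  ∣ X ∩ ⁅ v ⁆ ∣ + ∣ X ∪ ⁅ v ⁆ ∣  ≡⟨ ∣∩∣+∣∪∣ X ⁅ v ⁆ ⟩
  ∣ X ∣ + ∣ ⁅ v ⁆ ∣              ≡⟨ cong (∣ X ∣ +_) (∣⁅x⁆∣≡1 v) ⟩
  ∣ X ∣ + 1                      ≡⟨ +-comm ∣ X ∣ 1 ⟩
  suc ∣ X ∣                      ∎
  where open ≤-Reasoning

infix 4 _⟂_

_⟂_ : Subset n → Subset n → Set
X ⟂ Y = ∀ {x} → x ∈ X → x ∉ Y

record Separates (Q R X : Subset n) : Set where
  field
    contains : Q ⊆ X
    avoids   : X ⟂ R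

open Separates public

separates-∩ : ∀ {Q R X Y : Subset n} → Separates Q R X → Separates Q R Y → Separates Q R (X ∩ Y)
separates-∩ {X = X} {Y} x y = record
  { contains = λ q → x∈p∩q⁺ (contains x q , contains y q)
  ; avoids   = avoids x ∘ p∩q⊆p X Y
  }

separates-∪ : ∀ {Q R X Y : Subset n} → Separates Q R X → Separates Q R Y → Separates Q R (X ∪ Y)
separates-∪ {X = X} {Y} x y = record
  { contains = p⊆p∪q Y ∘ contains x
  ; avoids   = λ z → [ avoids x , avoids y ]′ (x∈p∪q⁻ X Y z)
  }

separates-◂ : ∀ {Q R X : Subset n} {v} → Separates Q R X → v ∉ R → Separates Q R (X ◂ v)
separates-◂ x v∉R = record
  { contains = ∈-◂ˡ ∘ contains x
  ; avoids   = λ z → [ avoids x , (λ { refl → v∉R }) ]′ (∈-◂⁻ z)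
  }

separates-shrink : ∀ {Q Q′ R R′ X : Subset n} → Q′ ⊆ Q → R′ ⊆ R → Separates Q R X → Separates Q′ R′ X
separates-shrink Q′⊆Q R′⊆R x = record
  { contains = contains x ∘ Q′⊆Q
  ; avoids   = λ z → avoids x z ∘ R′⊆R
  }

separates-∁ : ∀ {Q R X : Subset n} → Separates Q R X → Separates R Q (∁ X)
separates-∁ x = record
  { contains = λ r → x∉p⇒x∈∁p (λ z → avoids x z r)
  ; avoids   = λ z q → x∈∁p⇒x∉p z (contains x q)
  }

separates? : (Q R X : Subset n) → Dec (Separates Q R X)
separates? Q R X with Q ⊆? X | X ⊆? ∁ R
... | no ¬q | _     = no (¬q ∘ contains)
... | yes _ | no ¬r = no (λ x → ¬r (x∉p⇒x∈∁p ∘ avoids x))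
... | yes q | yes r = yes record { contains = q ; avoids = x∈∁p⇒x∉p ∘ r }

-- Minimum cuts of a submodular function

module Submodular {n : ℕ} (ρ : Subset n → ℕ)
  (ρ-submodular : ∀ X Y → ρ (X ∩ Y) + ρ (X ∪ Y) ≤ ρ X + ρ Y) where

  Linked : Subset n → Subset n → ℕ → Set
  Linked Q R k = ∀ {X} → Separates Q R X → k ≤ ρ X

  -- The minimum cuts: for a linked pair `ρ≤` is an equality.
  record Tight (Q R : Subset n) (k : ℕ) (X : Subset n) : Set where
    field
      separates : Separates Q R X
      ρ≤        : ρ X ≤ k

  open Tight public

  module _ {Q R k} (linked : Linked Q R k) where

    -- Uncrossing: the union also separates, so its value is at least `k`, which leaves at most `k`
    -- for the intersection.
    tight-∩ : ∀ {X Y} → Tight Q R k X → Tight Q R k Y → Tight Q R k (X ∩ Y)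
    tight-∩ {X} {Y} x y = record
      { separates = separates-∩ (separates x) (separates y)
      ; ρ≤ = +-cancelʳ-≤ k _ _ (≤-trans
          (+-monoʳ-≤ _ (linked (separates-∪ (separates x) (separates y))))
          (≤-trans (ρ-submodular X Y) (+-mono-≤ (ρ≤ x) (ρ≤ y))))
      }

    tight-∪ : ∀ {X Y} → Tight Q R k X → Tight Q R k Y → Tight Q R k (X ∪ Y)
    tight-∪ {X} {Y} x y = record
      { separates = separates-∪ (separates x) (separates y)
      ; ρ≤ = +-cancelˡ-≤ k _ _ (≤-trans
          (+-monoˡ-≤ _ (linked (separates-∩ (separates x) (separates y))))
          (≤-trans (ρ-submodular X Y) (+-mono-≤ (ρ≤ x) (ρ≤ y))))
      }

    -- `A ∪ Y` still separates, so it costs at least as much as `A`. Hence restricting `Y` to a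
    -- minimum cut never raises `ρ`.
    ρ-∩-tight : ∀ {A Y} → Tight Q R k A → Y ⟂ R → ρ (A ∩ Y) ≤ ρ Y
    ρ-∩-tight {A} {Y} a Y⟂R = +-cancelʳ-≤ k _ _ (begin
      ρ (A ∩ Y) + k          ≤⟨ +-monoʳ-≤ _ (linked record
        { contains = p⊆p∪q Y ∘ contains (separates a)
        ; avoids   = λ z → [ avoids (separates a) , Y⟂R ]′ (x∈p∪q⁻ A Y z) }) ⟩
      ρ (A ∩ Y) + ρ (A ∪ Y)  ≤⟨ ρ-submodular A Y ⟩
      ρ A + ρ Y              ≤⟨ +-monoˡ-≤ _ (ρ≤ a) ⟩
      k + ρ Y                ≡⟨ +-comm k _ ⟩
      ρ Y + k                ∎)
      where open ≤-Reasoning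

  tight-shrink : ∀ {Q Q′ R R′ k X} → Q′ ⊆ Q → R′ ⊆ R → Tight Q R k X → Tight Q′ R′ k X
  tight-shrink Q′⊆Q R′⊆R x = record { separates = separates-shrink Q′⊆Q R′⊆R (separates x) ; ρ≤ = ρ≤ x }

  ⋃-tight : ∀ {Q R k} → Linked Q R k → (base : Subset n) → Tight Q R k base →
            (xs : List (Fin n)) → (∀ {x} → x ∈ₗ xs → ∃ λ X → x ∈ X × Tight Q R k X) →
            ∃ λ X → Tight Q R k X × (∀ {x} → x ∈ₗ xs → x ∈ X)
  ⋃-tight linked base b []       f = base , b , λ ()
  ⋃-tight linked base b (x ∷ xs) f =
    let (X , x∈X , tX)   = f (here refl)
        (Y , tY , xs⊆Y) = ⋃-tight linked base b xs (f ∘ there)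
    in X ∪ Y , tight-∪ linked tX tY ,
       λ { (here refl) → p⊆p∪q Y x∈X ; (there y∈) → q⊆p∪q X Y (xs⊆Y y∈) }

  linked-half : ∀ {S T ℓ} → S ⟂ T → Linked S T ℓ → ∀ m → m ≤ ℓ →
                ∃ λ S′ → S′ ⊆ S × ∣ S′ ∣ ≤ m × Linked S′ T m
  linked-half {S} {T} {ℓ} S⟂T linked zero    _   = ⊥ , ⊥⊆ , ≤-reflexive (∣⊥∣≡0 n) , λ _ → z≤n
  linked-half {S} {T} {ℓ} S⟂T linked (suc m) m<ℓ
    with S′ , S′⊆S , size , linked′ ← linked-half S⟂T linked m (<⇒≤ m<ℓ)
    with tight? ← (λ S″ → anySubset? (λ X → separates? S″ T X ×-dec (ρ X ≤? m)))
    with tight? S′ | Fin.any? (λ x → x ∈? S ×-dec ¬? (tight? (S′ ◂ x)))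
  ... | no none | _ = S′ , S′⊆S , m≤n⇒m≤1+n size , λ sX → ≰⇒> (λ ρX≤m → none (_ , sX , ρX≤m))
  ... | yes _ | yes (x , x∈S , none) =
        S′ ◂ x , ◂-⊆ S′⊆S x∈S , ≤-trans (∣◂∣≤ S′ x) (s≤s size) ,
        λ sX → ≰⇒> (λ ρX≤m → none (_ , sX , ρX≤m))
  ... | yes (B , sB , ρB≤m) | no all =
        -- Otherwise every element of S lies in a set tight for S′ and T, and the
        -- union of those is tight and contains S.
        let (X , tX , S⊆X) = ⋃-tight linked′ B record { separates = sB ; ρ≤ = ρB≤m }
                                     (filter (_∈? S) (allFin n)) cover
        in contradiction (linked record { contains = λ x∈S → S⊆X (∈-filter⁺ (_∈? S) (∈-allFin _) x∈S)
                                        ; avoids   = avoids (separates tX) })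
                         (<⇒≱ (≤-<-trans (ρ≤ tX) m<ℓ))
    where
    cover : ∀ {x} → x ∈ₗ filter (_∈? S) (allFin n) → ∃ λ X → x ∈ X × Tight S′ T m X
    cover {x} x∈ with tight? (S′ ◂ x)
    ... | yes (X , sX , ρX≤m) = X , contains sX ∈-◂ʳ , record
          { separates = separates-shrink ∈-◂ˡ ⊆-refl sX ; ρ≤ = ρX≤m }
    ... | no none = contradiction (x , proj₂ (∈-filter⁻ (_∈? S) {xs = allFin n} x∈) , none) all

module Connectivity {n : ℕ} (ρ : Subset n → ℕ)
  (ρ-submodular : ∀ X Y → ρ (X ∩ Y) + ρ (X ∪ Y) ≤ ρ X + ρ Y)
  (ρ-compl : ∀ X → ρ (∁ X) ≡ ρ X) where

  open Submodular ρ ρ-submodular public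

  linked-swap : ∀ {Q R k} → Linked Q R k → Linked R Q k
  linked-swap linked sX = ≤-trans (linked (separates-∁ sX)) (≤-reflexive (ρ-compl _))

  -- First `S` is shrunk against `T`, then `T` against the core `S′` already found; complementation
  -- exchanges the two roles.
  linked-core : ∀ {S T ℓ} → S ⟂ T → Linked S T ℓ →
                ∃ λ S′ → ∃ λ T′ → S′ ⊆ S × T′ ⊆ T × ∣ S′ ∣ ≤ ℓ × ∣ T′ ∣ ≤ ℓ × Linked S′ T′ ℓ
  linked-core {ℓ = ℓ} S⟂T linked =
    let (S′ , S′⊆S , s , linked₁) = linked-half S⟂T linked ℓ ≤-refl
        (T′ , T′⊆T , t , linked₂) = linked-half (λ t s → S⟂T (S′⊆S s) t) (linked-swap linked₁) ℓ ≤-refl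
    in S′ , T′ , S′⊆S , T′⊆T , s , t , linked-swap linked₂

  tight-∁ : ∀ {Q R k X} → Tight Q R k X → Tight R Q k (∁ X)
  tight-∁ x = record { separates = separates-∁ (separates x) ; ρ≤ = ≤-trans (≤-reflexive (ρ-compl _)) (ρ≤ x) }

  ρ-─-tight : ∀ {Q R k} → Linked Q R k → ∀ {A Y} → Tight Q R k A → Y ⟂ Q → ρ (∁ A ∩ Y) ≤ ρ Y
  ρ-─-tight linked a Y⟂Q = ρ-∩-tight (linked-swap linked) (tight-∁ a) Y⟂Q

  -- A linear order on the points encoded by nested minimum cuts: `p i` precedes `p j` when
  -- `set i ◂ p i ⊆ set j`.
  record TightChain {N : ℕ} (p : Fin N → Fin n) (Q R : Subset n) (k : ℕ) : Set where
    field
      set    : Fin N → Subset n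
      tight  : ∀ i → Tight Q R k (set i)
      tight◂ : ∀ i → Tight Q R k (set i ◂ p i)
      ∉set   : ∀ i → p i ∉ set i
      total  : ∀ {i j} → i ≢ j → set i ◂ p i ⊆ set j ⊎ set j ◂ p j ⊆ set i

-- Uncrossing a family of cuts into a chain

module Chain {N n : ℕ} (p : Fin N → Fin n) (p-injective : ∀ {i j} → p i ≡ p j → i ≡ j)
  (P : Subset n → Set)
  (P-∩ : ∀ {X Y} → P X → P Y → P (X ∩ Y)) (P-∪ : ∀ {X Y} → P X → P Y → P (X ∪ Y))
  (X : Fin N → Subset n) (p∉X : ∀ i → p i ∉ X i)
  (P-X : ∀ i → P (X i)) (P-X◂ : ∀ i → P (X i ◂ p i)) where

  -- Order the points lexicographically by their positions relative to the sets
  -- X w, for w in the list: inside X w comes first, then p w itself, then the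
  -- rest.  chain ws i is the set of elements strictly before p i.
  chain : List (Fin N) → Fin N → Subset n
  chain []       i = X i
  chain (w ∷ ws) i with p i ∈? X w | i ≟ w
  ... | yes _ | _     = X w ∩ chain ws i
  ... | no _  | yes _ = X w
  ... | no _  | no _  = (X w ◂ p w) ∪ chain ws i

  private
    outside-◂ : ∀ {i w} → p i ∉ X w → i ≢ w → p i ∉ X w ◂ p w
    outside-◂ pi∉ i≢w = ∉-◂ pi∉ (i≢w ∘ p-injective)

    ∩-◂ : {Y Z : Subset n} {v : Fin n} → v ∈ Y → Y ∩ (Z ◂ v) ≡ (Y ∩ Z) ◂ v
    ∩-◂ {Y} {Z} {v} v∈Y = ⊆-antisym
      (λ x∈ → let (y , z) = x∈p∩q⁻ Y (Z ◂ v) x∈ in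
        [ (λ x∈Z → ∈-◂ˡ (x∈p∩q⁺ (y , x∈Z))) , (λ { refl → ∈-◂ʳ }) ]′ (∈-◂⁻ z))
      (◂-⊆ (λ x∈ → let (y , z) = x∈p∩q⁻ Y Z x∈ in x∈p∩q⁺ (y , ∈-◂ˡ z))
           (x∈p∩q⁺ (v∈Y , ∈-◂ʳ)))

  chain-∉ : ∀ ws i → p i ∉ chain ws i
  chain-∉ []       i = p∉X i
  chain-∉ (w ∷ ws) i with p i ∈? X w | i ≟ w
  ... | yes _  | _       = chain-∉ ws i ∘ p∩q⊆q (X w) _
  ... | no pi∉ | yes _   = pi∉
  ... | no pi∉ | no i≢w  = [ outside-◂ pi∉ i≢w , chain-∉ ws i ]′ ∘ x∈p∪q⁻ (X w ◂ p w) _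

  chain-P : ∀ ws i → P (chain ws i)
  chain-P []       i = P-X i
  chain-P (w ∷ ws) i with p i ∈? X w | i ≟ w
  ... | yes _ | _     = P-∩ (P-X w) (chain-P ws i)
  ... | no _  | yes _ = P-X w
  ... | no _  | no _  = P-∪ (P-X◂ w) (chain-P ws i)

  chain-P◂ : ∀ ws i → P (chain ws i ◂ p i)
  chain-P◂ []       i = P-X◂ i
  chain-P◂ (w ∷ ws) i with p i ∈? X w | i ≟ w
  ... | yes pi∈ | _        = subst P (∩-◂ pi∈) (P-∩ (P-X w) (chain-P◂ ws i))
  ... | no _    | yes refl = P-X◂ w
  ... | no _    | no _     = subst P (sym (∪-assoc (X w ◂ p w) (chain ws i) ⁅ p i ⁆))
                                     (P-∪ (P-X◂ w) (chain-P◂ ws i))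

  -- The first `w` for which `p i` and `p j` have different positions relative to `X w` and `p w`
  -- decides. One exists, since `i` and `j` are themselves in the list.
  chain-total : ∀ ws {i j} → i ∈ₗ ws → j ∈ₗ ws → i ≢ j →
                chain ws i ◂ p i ⊆ chain ws j ⊎ chain ws j ◂ p j ⊆ chain ws i
  chain-total (w ∷ ws) {i} {j} i∈ j∈ i≢j with p i ∈? X w | i ≟ w | p j ∈? X w | j ≟ w
  ... | yes pi∈ | yes refl | _ | _ = contradiction pi∈ (p∉X i)
  ... | _ | _ | yes pj∈ | yes refl = contradiction pj∈ (p∉X j)
  ... | no _ | yes refl | no _ | yes refl = contradiction refl i≢j
  ... | yes pi∈ | no _ | no _ | yes refl = inj₁ (◂-⊆ (p∩q⊆p (X w) _) pi∈)
  ... | no _ | yes refl | yes pj∈ | no _ = inj₂ (◂-⊆ (p∩q⊆p (X w) _) pj∈)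
  ... | yes pi∈ | no _ | no _ | no _ = inj₁ (p⊆p∪q _ ∘ ∈-◂ˡ ∘ ◂-⊆ (p∩q⊆p (X w) _) pi∈)
  ... | no _ | no _ | yes pj∈ | no _ = inj₂ (p⊆p∪q _ ∘ ∈-◂ˡ ∘ ◂-⊆ (p∩q⊆p (X w) _) pj∈)
  ... | no _ | yes refl | no _ | no _ = inj₁ (p⊆p∪q _)
  ... | no _ | no _ | no _ | yes refl = inj₂ (p⊆p∪q _)
  ... | yes pi∈ | no i≢w | yes pj∈ | no j≢w =
        Sum.map (inner pi∈) (inner pj∈) (chain-total ws (Any.tail i≢w i∈) (Any.tail j≢w j∈) i≢j)
    where
    inner : ∀ {i j} → p i ∈ X w → chain ws i ◂ p i ⊆ chain ws j →
            (X w ∩ chain ws i) ◂ p i ⊆ X w ∩ chain ws j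
    inner pi∈ i⊆j = ◂-⊆
      (λ x∈ → let (y , z) = x∈p∩q⁻ (X w) _ x∈ in x∈p∩q⁺ (y , i⊆j (∈-◂ˡ z)))
      (x∈p∩q⁺ (pi∈ , i⊆j ∈-◂ʳ))
  ... | no _ | no i≢w | no _ | no j≢w =
        Sum.map outer outer (chain-total ws (Any.tail i≢w i∈) (Any.tail j≢w j∈) i≢j)
    where
    outer : ∀ {i j} → chain ws i ◂ p i ⊆ chain ws j →
            ((X w ◂ p w) ∪ chain ws i) ◂ p i ⊆ (X w ◂ p w) ∪ chain ws j
    outer {i} {j} i⊆j = ◂-⊆
      ([ p⊆p∪q _ , q⊆p∪q (X w ◂ p w) _ ∘ i⊆j ∘ ∈-◂ˡ ]′ ∘ x∈p∪q⁻ (X w ◂ p w) _)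
      (q⊆p∪q (X w ◂ p w) _ (i⊆j ∈-◂ʳ))

-- Graphs

module CutOf {n : ℕ} (G : Graph n) = SymmetricMatrix (adj G) (adj-sym G)
open CutOf using () renaming (R to Rᴳ; ρ to ρᴳ)

∈-─⁻ : (p q : Subset n) → ∀ {x} → x ∈ p ─ q → x ∈ p × x ∉ q
∈-─⁻ p q {x} x∈ = p─q⊆p p q x∈ , ∉q p q x∈
  where
  ∉q : ∀ {n} (p q : Subset n) {x} → x ∈ p ─ q → x ∉ q
  ∉q (_ ∷ p) (true ∷ q) () here
  ∉q (_ ∷ p) (_ ∷ q) (there x∈) (there x∈q) = ∉q p q x∈ x∈q

xor-cancelʳ : ∀ x y → (x xor y) xor y ≡ x
xor-cancelʳ x y = trans (Bool.xor-assoc x y y) (trans (cong (x xor_) (Bool.xor-same y)) (Bool.xor-identityʳ x))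

-- Connectivity and separating sets

module _ (G : Graph n) (S T : Subset n) where

  private
    between? : (X : Subset n) → Dec (S ⊆ X × X ⊆ V G ─ T)
    between? X = S ⊆? X ×-dec X ⊆? (V G ─ T)

    cutRanks : List ℕ
    cutRanks = map (cutRank G) (filter between? (subsets n))

  κ≤cutRank : ∀ {X} → S ⊆ X → X ⊆ V G ─ T → κ G S T ≤ cutRank G X
  κ≤cutRank {X} S⊆X X⊆ = All.lookup (min≤xs (cutRank G S) cutRanks)
    (∈-map⁺ (cutRank G) (∈-filter⁺ between? (∈-subsets X) (S⊆X , X⊆)))

  κ-attained : S ⊆ V G ─ T → ∃ λ X → S ⊆ X × X ⊆ V G ─ T × κ G S T ≡ cutRank G X
  κ-attained S⊆ with argmin-sel id (cutRank G S) cutRanks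
  ... | inj₁ eq = S , ⊆-refl , S⊆ , eq
  ... | inj₂ κ∈ with ∈-map⁻ (cutRank G) κ∈
  ... | X , X∈ , eq with proj₂ (∈-filter⁻ between? {xs = subsets n} X∈)
  ... | S⊆X , X⊆ = X , S⊆X , X⊆ , eq

module _ (G : Graph n) where

  adj-∉ : ∀ x {y} → y ∉ V G → adj G x y ≡ false
  adj-∉ x {y} y∉V with adj G x y in eq
  ... | false = refl
  ... | true  = contradiction (adj-V G y x (Equivalence.from T-≡ (trans (adj-sym G y x) eq))) y∉V

  ∖-adj : ∀ {v x y} → x ≢ v → y ≢ v → adj (G ∖ v) x y ≡ adj G x y
  ∖-adj {v} {x} {y} x≢v y≢v
    rewrite dec-false (x ≟ v) x≢v | dec-false (y ≟ v) y≢v = Bool.∧-identityʳ (adj G x y)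

  -- `ρᴳ` uses all ambient columns outside `X`; those outside `V G` are zero.
  ρ≤cutRank : ∀ X → ρᴳ G X ≤ cutRank G X
  ρ≤cutRank X = rank-mono-kernel {M = adj G} (λ {c} c⊆ c0 y y∉X → vanish c c0 (x∈∁p⇒x∉p y∉X))
    where
    vanish : ∀ c → (∀ y → y ∈ V G ─ X → combination (adj G) c y ≡ false) →
             ∀ {y} → y ∉ X → combination (adj G) c y ≡ false
    vanish c c0 {y} y∉X with y ∈? V G
    ... | yes y∈V = c0 y (x∈p∧x∉q⇒x∈p─q y∈V y∉X)
    ... | no y∉V  = ⟨,⟩-zero c (λ x → adj G x y) (λ _ → adj-∉ _ y∉V)

module _ (G : Graph n) {S T : Subset n} (S⊆V : S ⊆ V G) where

  κ≤ρ : ∀ {X} → Separates S T X → κ G S T ≤ ρᴳ G X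
  κ≤ρ {X} sX = ≤-trans
    -- A separating set may leave `V G`; only its part inside competes in the minimum.
    (κ≤cutRank G S T {X ∩ V G} (λ q → x∈p∩q⁺ (contains sX q , S⊆V q))
      (λ x∈ → let (x∈X , x∈V) = x∈p∩q⁻ X (V G) x∈ in x∈p∧x∉q⇒x∈p─q x∈V (avoids sX x∈X)))
    (rank-mono {M = adj G} (p∩q⊆p X (V G))
      (λ y∈ → let (y∈V , y∉) = ∈-─⁻ (V G) (X ∩ V G) y∈
              in x∉p⇒x∈∁p (λ y∈X → y∉ (x∈p∩q⁺ (y∈X , y∈V))))
      (λ _ _ _ _ → refl))

  κ-separation : S ⟂ T → ∃ λ X → Separates S T X × X ⊆ V G × cutRank G X ≤ κ G S T
  κ-separation S⟂T =
    let (X , S⊆X , X⊆ , eq) = κ-attained G S T (λ s → x∈p∧x∉q⇒x∈p─q (S⊆V s) (S⟂T s))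
    in X , record { contains = S⊆X ; avoids = proj₂ ∘ ∈-─⁻ (V G) T ∘ X⊆ }
     , proj₁ ∘ ∈-─⁻ (V G) T ∘ X⊆ , ≤-reflexive (sym eq)

module _ (G : Graph n) {S T : Subset n} {v : Fin n} (S⊆V : S ⊆ V G) (v∉S : v ∉ S) where

  private
    S⊆V- : S ⊆ V (G ∖ v)
    S⊆V- q = x∈p∧x≢y⇒x∈p-y (S⊆V q) (λ { refl → v∉S q })

    ∈-V- : ∀ {x} → x ∈ V G - v → x ∈ V G × x ≢ v
    ∈-V- x∈ = let (x∈V , x∉) = ∈-─⁻ (V G) ⁅ v ⁆ x∈ in x∈V , λ { refl → x∉ (x∈⁅x⁆ v) }

  κ-∖≤ρ : ∀ {X} → Separates S T X → κ (G ∖ v) S T ≤ ρᴳ G X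
  κ-∖≤ρ {X} sX = ≤-trans
    (κ≤cutRank (G ∖ v) S T {X ∩ (V G - v)} (λ q → x∈p∩q⁺ (contains sX q , S⊆V- q))
      (λ x∈ → let (x∈X , x∈V) = x∈p∩q⁻ X (V G - v) x∈ in x∈p∧x∉q⇒x∈p─q x∈V (avoids sX x∈X)))
    (rank-mono {M = adj (G ∖ v)} {adj G} (p∩q⊆p X (V G - v))
      (λ y∈ → let (y∈V , y∉) = ∈-─⁻ (V G - v) (X ∩ (V G - v)) y∈
              in x∉p⇒x∈∁p (λ y∈X → y∉ (x∈p∩q⁺ (y∈X , y∈V))))
      (λ x y x∈ y∈ → ∖-adj G (proj₂ (∈-V- (p∩q⊆q X (V G - v) x∈)))
                            (proj₂ (∈-V- (p─q⊆p (V G - v) (X ∩ (V G - v)) y∈)))))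

  -- A minimum cut of `G ∖ v`, measured in `G` by the rank that appears in `τ delete`.
  κ-∖-separation : S ⟂ T → ∃ λ X → Separates S T X × v ∉ X × Rᴳ G X (X ◂ v) ≤ κ (G ∖ v) S T
  κ-∖-separation S⟂T =
    let (X , sX , X⊆V- , r) = κ-separation (G ∖ v) S⊆V- S⟂T
        v∉X = λ v∈X → proj₂ (∈-V- (X⊆V- v∈X)) refl
    in X , sX , v∉X , ≤-trans (bound v∉X) (≤-trans (ρ≤cutRank (G ∖ v) X) r)
    where
    bound : ∀ {X} → v ∉ X → Rᴳ G X (X ◂ v) ≤ ρᴳ (G ∖ v) X
    bound {X} v∉X = rank-mono {M = adj G} {adj (G ∖ v)} {X} {X} {∁ (X ◂ v)} {∁ X} ⊆-refl (p⊆q⇒∁p⊇∁q ∈-◂ˡ)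
      (λ x y x∈ y∈ → sym (∖-adj G (λ { refl → v∉X x∈ }) (λ { refl → x∈∁p⇒x∉p y∈ ∈-◂ʳ })))

-- Local complementation and pivoting

module _ (G : Graph n) (u : Fin n) where

  private
    f : Fin n → Bool
    f = adj G u

  ✶-adj : ∀ {x y} → x ≢ y → adj (G ✶ u) x y ≡ adj G x y xor (f x ∧ f y)
  ✶-adj {x} {y} x≢y rewrite dec-false (x ≟ y) x≢y = cong (adj G x y xor_) (Bool.∧-identityʳ (f x ∧ f y))

  ✶-adjˡ : ∀ y → adj (G ✶ u) u y ≡ adj G u y
  ✶-adjˡ y rewrite adj-irrefl G u = Bool.xor-identityʳ (adj G u y)

  ✶-adjʳ : ∀ x → adj (G ✶ u) x u ≡ f x
  ✶-adjʳ x = trans (adj-sym (G ✶ u) x u) (✶-adjˡ x)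

  module _ {X Y : Subset n} (X⟂Y : X ⟂ Y) where

    private
      ✶≡ : ∀ x y → x ∈ X → y ∈ Y → adj (G ✶ u) x y ≡ adj G x y xor (f x ∧ f y)
      ✶≡ x y x∈ y∈ = ✶-adj (λ { refl → X⟂Y x∈ y∈ })

      ≡✶ : ∀ x y → x ∈ X → y ∈ Y → adj G x y ≡ adj (G ✶ u) x y xor (f x ∧ f y)
      ≡✶ x y x∈ y∈ = trans (sym (xor-cancelʳ _ (f x ∧ f y))) (cong (_xor (f x ∧ f y)) (sym (✶≡ x y x∈ y∈)))

    -- Between disjoint sets, local complementation adds row `u` to the rows of its neighbours if
    -- `u ∈ X`, or column `u` to the columns of its neighbours if `u ∈ Y`.
    rank-✶≤ : u ∈ X ⊎ u ∈ Y → rank (adj (G ✶ u)) X Y ≤ rank (adj G) X Y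
    rank-✶≤ (inj₁ u∈X) = rank-addRow (adj G) (adj (G ✶ u)) f u∈X ✶≡
    rank-✶≤ (inj₂ u∈Y) = rank-addColumn (adj G) (adj (G ✶ u)) f u∈Y
      (λ x y x∈ y∈ → trans (✶≡ x y x∈ y∈) (cong (λ b → adj G x y xor (b ∧ f y)) (adj-sym G u x)))

    rank≤rank-✶ : u ∈ X ⊎ u ∈ Y → rank (adj G) X Y ≤ rank (adj (G ✶ u)) X Y
    rank≤rank-✶ (inj₁ u∈X) = rank-addRow (adj (G ✶ u)) (adj G) f u∈X
      (λ x y x∈ y∈ → trans (≡✶ x y x∈ y∈)
        (cong (λ b → adj (G ✶ u) x y xor (f x ∧ b)) (sym (✶-adjˡ y))))
    rank≤rank-✶ (inj₂ u∈Y) = rank-addColumn (adj (G ✶ u)) (adj G) f u∈Y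
      (λ x y x∈ y∈ → trans (≡✶ x y x∈ y∈)
        (cong (λ b → adj (G ✶ u) x y xor (b ∧ f y)) (sym (✶-adjʳ x))))

  ρ-✶≤ : ∀ X → ρᴳ (G ✶ u) X ≤ ρᴳ G X
  ρ-✶≤ X = rank-✶≤ (λ x x∈∁ → x∈∁p⇒x∉p x∈∁ x) side
    where
    side : u ∈ X ⊎ u ∈ ∁ X
    side with u ∈? X
    ... | yes u∈X = inj₁ u∈X
    ... | no u∉X  = inj₂ (x∉p⇒x∈∁p u∉X)

ρ-pivot≤ : (G : Graph n) (u v : Fin n) (X : Subset n) → ρᴳ (pivot G u v) X ≤ ρᴳ G X
ρ-pivot≤ G u v X = ≤-trans (ρ-✶≤ (G ✶ u ✶ v) u X) (≤-trans (ρ-✶≤ (G ✶ u) v X) (ρ-✶≤ G u X))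

module _ (G : Graph n) {u v : Fin n} (vu : Adjacent G v u) {Z : Subset n} (v∉Z : v ∉ Z) where

  private
    u≢v : u ≢ v
    u≢v refl = subst Bool.T (adj-irrefl G v) vu

    uv : adj G u v ≡ true
    uv = trans (adj-sym G u v) (Equivalence.to T-≡ vu)

    a : Fin n → Bool
    a = adj G u

    -- Local complementation at u without removing the loops it creates, followed
    -- by elimination with the loop at v as the pivot entry.
    M₁ M₂ : Matrix n n
    M₁ x y = adj G x y xor (a x ∧ a y)
    M₂ x y = M₁ x y xor (M₁ x v ∧ M₁ v y)

    M₁-row : ∀ y → M₁ u y ≡ a y
    M₁-row y = trans (cong (λ b → a y xor (b ∧ a y)) (adj-irrefl G u)) (Bool.xor-identityʳ (a y))

    M₁-col : ∀ x → M₁ x u ≡ a x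
    M₁-col x = trans (cong (λ b → adj G x u xor (a x ∧ b)) (adj-irrefl G u))
      (trans (cong (adj G x u xor_) (Bool.∧-zeroʳ (a x)))
      (trans (Bool.xor-identityʳ (adj G x u)) (adj-sym G x u)))

    M₁-vv : M₁ v v ≡ true
    M₁-vv rewrite uv | adj-irrefl G v = refl

    M₂-row : ∀ y → M₂ v y ≡ false
    M₂-row y = trans (cong (λ b → M₁ v y xor (b ∧ M₁ v y)) M₁-vv) (Bool.xor-same (M₁ v y))

    M₂-col : ∀ x → M₂ x v ≡ false
    M₂-col x = trans (cong (λ b → M₁ x v xor (M₁ x v ∧ b)) M₁-vv)
      (trans (cong (M₁ x v xor_) (Bool.∧-identityʳ (M₁ x v))) (Bool.xor-same (M₁ x v)))

    side : u ∈ Z ⊎ u ∈ ∁ (Z ◂ v)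
    side with u ∈? Z
    ... | yes u∈Z = inj₁ u∈Z
    ... | no u∉Z  = inj₂ (x∉p⇒x∈∁p (∉-◂ u∉Z u≢v))

    step₁ : u ∈ Z ⊎ u ∈ ∁ (Z ◂ v) → Rᴳ G (Z ◂ v) Z ≤ rank M₁ (Z ◂ v) (∁ Z)
    step₁ (inj₁ u∈Z) = rank-addRow M₁ (adj G) a (∈-◂ˡ u∈Z) (λ x y _ _ →
      trans (sym (xor-cancelʳ (adj G x y) (a x ∧ a y))) (cong (λ b → M₁ x y xor (a x ∧ b)) (sym (M₁-row y))))
    step₁ (inj₂ u∉Z) = rank-addColumn M₁ (adj G) a (p⊆q⇒∁p⊇∁q ∈-◂ˡ u∉Z) (λ x y _ _ →
      trans (sym (xor-cancelʳ (adj G x y) (a x ∧ a y))) (cong (λ b → M₁ x y xor (b ∧ a y)) (sym (M₁-col x))))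

    -- Eliminating with the entry at `v` subtracts the product of column `v` and row `v`.
    step₂ : rank M₁ (Z ◂ v) (∁ Z) ≤ suc (rank M₂ (Z ◂ v) (∁ Z))
    step₂ = rank-rankOne M₁ M₂ (λ x → M₁ x v) (M₁ v) (λ x y _ _ → sym (xor-cancelʳ (M₁ x y) _))

    step₃ : rank M₂ (Z ◂ v) (∁ Z) ≤ rank M₂ Z (∁ (Z ◂ v))
    step₃ = ≤-trans
      (rank-mono-cokernel {M = M₂} {X = Z} (λ {d} _ d0 x x∈ → rows d d0 (∈-◂⁻ x∈)))
      (rank-mono-kernel {M = M₂} {Y = ∁ (Z ◂ v)} (λ {c} _ c0 y y∈ → columns c c0 (y ≟ v) (x∈∁p⇒x∉p y∈)))
      where
      rows : ∀ d → (∀ x → x ∈ Z → ⟨ d , M₂ x ⟩ ≡ false) → ∀ {x} → x ∈ Z ⊎ x ≡ v → ⟨ d , M₂ x ⟩ ≡ false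
      rows d d0 (inj₁ x∈Z)  = d0 _ x∈Z
      rows d d0 (inj₂ refl) = ⟨,⟩-zero d (M₂ v) (λ _ → M₂-row _)

      columns : ∀ c → (∀ y → y ∈ ∁ (Z ◂ v) → combination M₂ c y ≡ false) →
                ∀ {y} → Dec (y ≡ v) → y ∉ Z → combination M₂ c y ≡ false
      columns c c0 (yes refl) _   = ⟨,⟩-zero c (λ x → M₂ x v) (λ _ → M₂-col _)
      columns c c0 (no y≢v)   y∉Z = c0 _ (x∉p⇒x∈∁p (∉-◂ y∉Z y≢v))

    step₄ : rank M₂ Z (∁ (Z ◂ v)) ≤ rank (adj (G ✶ u ✶ v)) Z (∁ (Z ◂ v))
    step₄ = rank-mono {M = M₂} {adj (G ✶ u ✶ v)} ⊆-refl ⊆-refl entry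
      where
      entry : ∀ x y → x ∈ Z → y ∈ ∁ (Z ◂ v) → M₂ x y ≡ adj (G ✶ u ✶ v) x y
      entry x y x∈Z y∈ = sym (trans (✶-adj (G ✶ u) v x≢y) (cong₂ _xor_ (✶-adj G u x≢y)
        (cong₂ _∧_ (trans (adj-sym (G ✶ u) v x) (✶-adj G u x≢v)) (✶-adj G u (y≢v ∘ sym)))))
        where
        y∉ = x∈∁p⇒x∉p y∈
        x≢y : x ≢ y
        x≢y refl = y∉ (∈-◂ˡ x∈Z)
        x≢v : x ≢ v
        x≢v refl = v∉Z x∈Z
        y≢v : y ≢ v
        y≢v refl = y∉ ∈-◂ʳ

  -- As `u` lies in `Z` or in `∁ (Z ◂ v)`, passing to `M₁` loses no rank. The edge `uv` makes the
  -- diagonal entry at `v` true; eliminating with it costs at most one and clears row and column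
  -- `v`. The rest agrees with `G ✶ u ✶ v`, and the last complementation at `u` loses no rank.
  rank-pivot-∖ : Rᴳ G (Z ◂ v) Z ≤ suc (Rᴳ (pivot G u v) Z (Z ◂ v))
  rank-pivot-∖ = ≤-trans (step₁ side) (≤-trans step₂ (s≤s (≤-trans step₃ (≤-trans step₄
    (rank≤rank-✶ (G ✶ u ✶ v) u (λ x∈Z x∈ → x∈∁p⇒x∉p x∈ (∈-◂ˡ x∈Z)) side)))))

-- Counting points in two orders

⊆∧∣∣≥⇒⊇ : {p q : Subset n} → p ⊆ q → ∣ q ∣ ≤ ∣ p ∣ → q ⊆ p
⊆∧∣∣≥⇒⊇ {p = p} p⊆q q≤p {x} x∈q with x ∈? p
... | yes x∈p = x∈p
... | no x∉p  = contradiction (p⊂q⇒∣p∣<∣q∣ (p⊆q , x , x∈q , x∉p)) (≤⇒≯ q≤p)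

∩-absorb : {X Y : Subset n} (Z : Subset n) → X ⊆ Y → X ∩ (Y ∩ Z) ≡ X ∩ Z
∩-absorb {X = X} {Y} Z X⊆Y = ⊆-antisym
  (λ x∈ → let (x , yz) = x∈p∩q⁻ X (Y ∩ Z) x∈ in x∈p∩q⁺ (x , p∩q⊆q Y Z yz))
  (λ x∈ → let (x , z) = x∈p∩q⁻ X Z x∈ in x∈p∩q⁺ (x , x∈p∩q⁺ (X⊆Y x , z)))

∩-exchange : (X Y Z : Subset n) → X ∩ (Y ∩ Z) ≡ Y ∩ (X ∩ Z)
∩-exchange X Y Z = trans (sym (∩-assoc X Y Z)) (trans (cong (_∩ Z) (∩-comm X Y)) (∩-assoc Y X Z))

∩-◂-∩ : (X Y : Subset n) {Z : Subset n} {v : Fin n} → v ∈ Z →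
        (X ∩ (Y ∩ Z)) ◂ v ≡ (X ◂ v) ∩ ((Y ◂ v) ∩ Z)
∩-◂-∩ X Y {Z} {v} v∈Z = trans (∪-distribʳ-∩ ⁅ v ⁆ X (Y ∩ Z))
  (cong ((X ◂ v) ∩_) (trans (∪-distribʳ-∩ ⁅ v ⁆ Y Z)
  (cong ((Y ◂ v) ∩_) (⊆-antisym (◂-⊆ ⊆-refl v∈Z) ∈-◂ˡ))))

2k≤2^k : ∀ k → 0 < k → 2 * k ≤ 2 ^ k
2k≤2^k (suc zero)    _ = ≤-refl
2k≤2^k (suc (suc k)) _ = begin
  2 * suc (suc k)        ≡⟨ *-suc 2 (suc k) ⟩
  2 + 2 * suc k          ≤⟨ +-mono-≤ (m≤m*n 2 (suc k)) (2k≤2^k (suc k) (s≤s z≤n)) ⟩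
  2 * suc k + 2 ^ suc k  ≤⟨ +-monoˡ-≤ (2 ^ suc k) (2k≤2^k (suc k) (s≤s z≤n)) ⟩
  2 ^ suc k + 2 ^ suc k  ≡⟨ cong (2 ^ suc k +_) (+-identityʳ (2 ^ suc k)) ⟨
  2 ^ suc (suc k)        ∎
  where open ≤-Reasoning

[2k]²≤2^2k : ∀ k → 0 < k → 2 * k * (2 * k) ≤ 2 ^ (2 * k)
[2k]²≤2^2k k 0<k = begin
  2 * k * (2 * k)    ≤⟨ *-mono-≤ (2k≤2^k k 0<k) (2k≤2^k k 0<k) ⟩
  2 ^ k * 2 ^ k      ≡⟨ ^-distribˡ-+-* 2 k k ⟨
  2 ^ (k + k)        ≡⟨ cong (λ m → 2 ^ (k + m)) (+-identityʳ k) ⟨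
  2 ^ (2 * k)        ∎
  where open ≤-Reasoning

-- Coding the points by a class and two cut-ranks

module Grid {n : ℕ} (ρ : Subset n → ℕ) (ρ-⊥ : ρ ⊥ ≡ 0)
  (ρ-submodular : ∀ X Y → ρ (X ∩ Y) + ρ (X ∪ Y) ≤ ρ X + ρ Y)
  (ρ-compl : ∀ X → ρ (∁ X) ≡ ρ X) where

  open Connectivity ρ ρ-submodular ρ-compl

  module Count {N : ℕ} {p : Fin N → Fin n} {Q R S T S′ T′ : Subset n} {k ℓ : ℕ}
    (QR : Linked Q R k) (ST : Linked S T ℓ)
    (ST′ : Linked S′ T′ ℓ) (S′⊆S : S′ ⊆ S) (T′⊆T : T′ ⊆ T)
    (∣S′∣≤ : ∣ S′ ∣ ≤ ℓ) (∣T′∣≤ : ∣ T′ ∣ ≤ ℓ)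
    (p∉S : ∀ i → p i ∉ S) (p∉T : ∀ i → p i ∉ T)
    (𝒜 : TightChain p Q R k) (ℬ : TightChain p S T ℓ)
    (strict : ∀ i {Z} → OneSide (p i) Z (TightChain.set 𝒜 i) → OneSide (p i) Z (TightChain.set ℬ i) →
              ρ Z < ρ (Z ◂ p i)) where

    open TightChain 𝒜 renaming (set to A; tight to A-tight; tight◂ to A◂-tight; ∉set to ∉A; total to A-total)
    open TightChain ℬ renaming (set to B; tight to B-tight; tight◂ to B◂-tight; ∉set to ∉B; total to B-total)

    private
      U = S′ ∪ T′

      ∣U∣≤ : ∣ U ∣ ≤ 2 * ℓ
      ∣U∣≤ = begin
        ∣ S′ ∪ T′ ∣                    ≤⟨ m≤n+m _ _ ⟩
        ∣ S′ ∩ T′ ∣ + ∣ S′ ∪ T′ ∣      ≡⟨ ∣∩∣+∣∪∣ S′ T′ ⟩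
        ∣ S′ ∣ + ∣ T′ ∣                ≤⟨ +-mono-≤ ∣S′∣≤ (≤-trans ∣T′∣≤ (≤-reflexive (sym (+-identityʳ ℓ)))) ⟩
        2 * ℓ                          ∎
        where open ≤-Reasoning

      p∉U : ∀ i → p i ∉ U
      p∉U i = [ p∉S i ∘ S′⊆S , p∉T i ∘ T′⊆T ]′ ∘ x∈p∪q⁻ S′ T′

    -- No element of U lies between points of the same class in the first order.
    class : Fin N → ℕ
    class i = ∣ A i ∩ U ∣

    private
      ⋂A : List (Fin N) → Subset n
      ⋂A []       = ⊤
      ⋂A (j ∷ js) = A j ∩ ⋂A js

      ⋂A⁻ : ∀ {js j x} → j ∈ₗ js → x ∈ ⋂A js → x ∈ A j
      ⋂A⁻ {j ∷ js} (here refl) = p∩q⊆p (A j) (⋂A js)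
      ⋂A⁻ {j ∷ js} (there j∈)  = ⋂A⁻ j∈ ∘ p∩q⊆q (A j) (⋂A js)

      ⋂A⁺ : ∀ {js x} → (∀ {j} → j ∈ₗ js → x ∈ A j) → x ∈ ⋂A js
      ⋂A⁺ {[]}     f = ∈⊤
      ⋂A⁺ {j ∷ js} f = x∈p∩q⁺ (f (here refl) , ⋂A⁺ (f ∘ there))

      ⋂A-tight : ∀ j js → Tight Q R k (⋂A (j ∷ js))
      ⋂A-tight j []        = subst (Tight Q R k) (sym (∩-identityʳ (A j))) (A-tight j)
      ⋂A-tight j (j′ ∷ js) = tight-∩ QR (A-tight j) (⋂A-tight j′ js)

      ρ-⋂A : ∀ js → ρ (⋂A js) ≤ k
      -- An empty class has the whole ambient set as its intersection, of cut-rank zero.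
      ρ-⋂A []       = ≤-trans (≤-reflexive (trans (sym (ρ-compl ⊤))
        (trans (cong ρ (⊆-antisym (λ x∈ → contradiction ∈⊤ (x∈∁p⇒x∉p x∈)) ⊥⊆)) ρ-⊥))) z≤n
      ρ-⋂A (j ∷ js) = ρ≤ (⋂A-tight j js)

      members : ℕ → List (Fin N)
      members c = filter (λ j → class j ℕ.≟ c) (allFin N)

      -- What precedes all points of class c; nothing has to be cut off for class 0.
      start : ℕ → Subset n
      start zero    = ⊥
      start (suc c) = ⋂A (members (suc c))

      ρ-start : ∀ c → ρ (start c) ≤ k
      ρ-start zero    = ≤-trans (≤-reflexive ρ-⊥) z≤n
      ρ-start (suc c) = ρ-⋂A (members (suc c))

      start⊆A : ∀ c i → class i ≡ c → start c ⊆ A i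
      start⊆A zero    i eq = ⊥⊆
      start⊆A (suc c) i eq = ⋂A⁻ (∈-filter⁺ (λ j → class j ℕ.≟ suc c) (∈-allFin i) eq)

      -- The sets of the chain are nested, so equal counts in `U` mean equal traces on `U`.
      A∩U⊆A : ∀ i j → class i ≡ class j → A i ∩ U ⊆ A j
      A∩U⊆A i j eq with i ≟ j
      ... | yes refl = p∩q⊆p (A i) U
      ... | no i≢j with A-total i≢j
      ...   | inj₁ i⊆j = i⊆j ∘ ∈-◂ˡ ∘ p∩q⊆p (A i) U
      ...   | inj₂ j⊆i = p∩q⊆p (A j) U ∘ ⊆∧∣∣≥⇒⊇
                (λ x∈ → let (a , u) = x∈p∩q⁻ (A j) U x∈ in x∈p∩q⁺ (j⊆i (∈-◂ˡ a) , u))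
                (≤-reflexive eq)

      A∩U⊆start : ∀ c i → class i ≡ c → A i ∩ U ⊆ start c
      A∩U⊆start zero i eq x∈ = contradiction
        (≤-<-trans z≤n (p⊂q⇒∣p∣<∣q∣ {p = ⊥} (⊥⊆ , _ , x∈ , ∉⊥))) (<-irrefl (sym eq))
      A∩U⊆start (suc c) i eq x∈ = ⋂A⁺ (λ {j} j∈ → A∩U⊆A i j
        (trans eq (sym (proj₂ (∈-filter⁻ (λ j → class j ℕ.≟ suc c) {xs = allFin N} j∈)))) x∈)

      C : ℕ → Subset n
      C c = ∁ (start c)

      -- The stretch of the first order from the start of class `c` up to and including `p i`.
      E : ℕ → Fin N → Subset n
      E c i = (A i ◂ p i) ∩ C c

      p∈C : ∀ i → p i ∈ C (class i)
      p∈C i = x∉p⇒x∈∁p (∉A i ∘ start⊆A (class i) i refl)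

      E⟂U : ∀ i → E (class i) i ⟂ U
      E⟂U i x∈E x∈U with x∈p∩q⁻ (A i ◂ p i) (C (class i)) x∈E
      ... | x∈A◂ , x∈C = x∈∁p⇒x∉p x∈C (A∩U⊆start (class i) i refl
              (x∈p∩q⁺ (◂-elim x∈A◂ (λ { refl → p∉U i x∈U }) , x∈U)))

      ρ-E : ∀ i → ρ (E (class i) i) ≤ k + ρ (start (class i))
      ρ-E i = ≤-trans (m≤m+n _ _) (≤-trans (ρ-submodular (A i ◂ p i) (C (class i)))
        (+-mono-≤ (ρ≤ (A◂-tight i)) (≤-reflexive (ρ-compl (start (class i))))))

      -- `a` and `b` measure what precedes `p i` within the class, on the near and the far side of
      -- `p i` in the second order. For `c` the class of `i`, the versions with a plus add `p i` to
      -- these sets.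
      a a⁺ b b⁺ : ℕ → Fin N → ℕ
      a  c i = ρ (B i ∩ (A i ∩ C c))
      a⁺ c i = ρ ((B i ◂ p i) ∩ E c i)
      b  c i = ρ (∁ (B i ◂ p i) ∩ (A i ∩ C c))
      b⁺ c i = ρ (∁ (B i) ∩ E c i)

      a<a⁺ : ∀ i → a (class i) i < a⁺ (class i) i
      a<a⁺ i = <-≤-trans
        (strict i (inj₁ (p∩q⊆p (A i) _ ∘ p∩q⊆q (B i) _)) (inj₁ (p∩q⊆p (B i) _)))
        (≤-reflexive (cong ρ (∩-◂-∩ (B i) (A i) (p∈C i))))

      b<b⁺ : ∀ i → b (class i) i < b⁺ (class i) i
      b<b⁺ i = <-≤-trans
        (strict i (inj₁ (p∩q⊆p (A i) _ ∘ p∩q⊆q (∁ (B i ◂ p i)) _)) (inj₂ (p∩q⊆p (∁ (B i ◂ p i)) _)))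
        (≤-reflexive (cong ρ (trans (∩-◂-∩ (∁ (B i ◂ p i)) (A i) (p∈C i))
          (cong (_∩ E (class i) i) (∁-◂-◂ (∉B i))))))

      -- `E` may meet `T` but not the core `T′`, and cuts tight for `S` and `T` stay tight for the
      -- core, so the restriction does not raise `ρ`.
      a⁺≤ : ∀ i → a⁺ (class i) i ≤ ρ (E (class i) i)
      a⁺≤ i = ρ-∩-tight ST′ (tight-shrink S′⊆S T′⊆T (B◂-tight i))
        (λ x∈ t → E⟂U i x∈ (x∈p∪q⁺ (inj₂ t)))

      b⁺≤ : ∀ i → b⁺ (class i) i ≤ ρ (E (class i) i)
      b⁺≤ i = ρ-─-tight ST′ (tight-shrink S′⊆S T′⊆T (B-tight i))
        (λ x∈ s → E⟂U i x∈ (x∈p∪q⁺ (inj₁ s)))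

      -- A subset of `A j` avoids `R`, so cutting it down to the minimum cut `A i ◂ p i` cannot
      -- raise `ρ`.
      shrink-A : ∀ c i j Y → A i ◂ p i ⊆ A j → ρ (Y ∩ E c i) ≤ ρ (Y ∩ (A j ∩ C c))
      shrink-A c i j Y i⊆j = ≤-trans
        (≤-reflexive (cong ρ (trans (cong (Y ∩_) (sym (∩-absorb (C c) i⊆j))) (∩-exchange Y (A i ◂ p i) _))))
        (ρ-∩-tight QR (A◂-tight i) (avoids (separates (A-tight j)) ∘ p∩q⊆p (A j) (C c) ∘ p∩q⊆q Y _))

      a⁺≤a : ∀ c i j → A i ◂ p i ⊆ A j → B i ◂ p i ⊆ B j → a⁺ c i ≤ a c j
      a⁺≤a c i j Ai⊆ Bi⊆ = begin
        ρ ((B i ◂ p i) ∩ E c i)          ≡⟨ cong ρ (∩-absorb (E c i) Bi⊆) ⟨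
        ρ ((B i ◂ p i) ∩ (B j ∩ E c i))  ≤⟨ ρ-∩-tight ST (B◂-tight i)
                                              (avoids (separates (B-tight j)) ∘ p∩q⊆p (B j) _) ⟩
        ρ (B j ∩ E c i)                  ≤⟨ shrink-A c i j (B j) Ai⊆ ⟩
        ρ (B j ∩ (A j ∩ C c))            ∎
        where open ≤-Reasoning

      -- The mirror image of `a⁺≤a`: with `p j` earlier in the second order, complements of the cuts
      -- `B` are nested and avoid `S`.
      b⁺≤b : ∀ c i j → A i ◂ p i ⊆ A j → B j ◂ p j ⊆ B i → b⁺ c i ≤ b c j
      b⁺≤b c i j Ai⊆ Bj⊆ = begin
        ρ (∁ (B i) ∩ E c i)                   ≡⟨ cong ρ (∩-absorb (E c i) (p⊆q⇒∁p⊇∁q Bj⊆)) ⟨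
        ρ (∁ (B i) ∩ (∁ (B j ◂ p j) ∩ E c i)) ≤⟨ ρ-─-tight ST (B-tight i)
          (λ x∈ s → x∈∁p⇒x∉p (p∩q⊆p (∁ (B j ◂ p j)) _ x∈) (contains (separates (B◂-tight j)) s)) ⟩
        ρ (∁ (B j ◂ p j) ∩ E c i)             ≤⟨ shrink-A c i j (∁ (B j ◂ p j)) Ai⊆ ⟩
        ρ (∁ (B j ◂ p j) ∩ (A j ∩ C c))       ∎
        where open ≤-Reasoning

      -- For `p i` before `p j` in the first order, `a` increases if the second order agrees and `b`
      -- increases if it disagrees.
      distinct : ∀ i j → A i ◂ p i ⊆ A j → i ≢ j → class i ≡ class j →
                 a (class i) i ≡ a (class j) j → b (class i) i ≢ b (class j) j
      distinct i j Ai⊆ i≢j c≡ a≡ b≡ with B-total i≢j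
      ... | inj₁ Bi⊆ = <⇒≢ (<-≤-trans (a<a⁺ i) (≤-trans (a⁺≤a (class i) i j Ai⊆ Bi⊆)
                         (≤-reflexive (cong (λ c → a c j) c≡)))) a≡
      ... | inj₂ Bj⊆ = <⇒≢ (<-≤-trans (b<b⁺ i) (≤-trans (b⁺≤b (class i) i j Ai⊆ Bj⊆)
                         (≤-reflexive (cong (λ c → b c j) c≡)))) b≡

      code-injective : ∀ i j → class i ≡ class j → a (class i) i ≡ a (class j) j →
                       b (class i) i ≡ b (class j) j → i ≡ j
      code-injective i j c≡ a≡ b≡ with i ≟ j
      ... | yes i≡j = i≡j
      ... | no i≢j with A-total i≢j
      ...   | inj₁ Ai⊆ = contradiction b≡ (distinct i j Ai⊆ i≢j c≡ a≡)
      ...   | inj₂ Aj⊆ = contradiction (sym b≡) (distinct j i Aj⊆ (i≢j ∘ sym) (sym c≡) (sym a≡))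

      class< : ∀ i → class i < 2 * ℓ + 1
      class< i = ≤-trans (s≤s (≤-trans (∣p∩q∣≤∣q∣ (A i) U) ∣U∣≤)) (≤-reflexive (+-comm 1 (2 * ℓ)))

      E≤ : ∀ i → ρ (E (class i) i) ≤ 2 * k
      E≤ i = ≤-trans (ρ-E i) (+-monoʳ-≤ k (≤-trans (ρ-start (class i)) (≤-reflexive (sym (+-identityʳ k)))))

      a< : ∀ i → a (class i) i < 2 * k
      a< i = <-≤-trans (a<a⁺ i) (≤-trans (a⁺≤ i) (E≤ i))

      b< : ∀ i → b (class i) i < 2 * k
      b< i = <-≤-trans (b<b⁺ i) (≤-trans (b⁺≤ i) (E≤ i))

      a<k : ∀ i → class i ≡ 0 → a (class i) i < k
      a<k i c≡0 = <-≤-trans (a<a⁺ i) (≤-trans (a⁺≤ i) (≤-trans (ρ-E i) (≤-reflexive (begin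
        k + ρ (start (class i))  ≡⟨ cong (λ c → k + ρ (start c)) c≡0 ⟩
        k + ρ ⊥                  ≡⟨ cong (k +_) ρ-⊥ ⟩
        k + 0                    ≡⟨ +-identityʳ k ⟩
        k                        ∎))))
        where open ≡-Reasoning

      code : Fin N → Fin ((2 * ℓ + 1) * (2 * k * (2 * k)))
      code i = combine (fromℕ< (class< i)) (combine (fromℕ< (a< i)) (fromℕ< (b< i)))

    -- In class 0 the first coordinate stays below k, so some code is never used.
    N< : 0 < k → N < (2 * ℓ + 1) * (2 * k * (2 * k))
    N< 0<k = Fin.injective⇒≤ {f = code′} (λ {i} {j} → code′-injective i j)
      where
      0<2ℓ+1 : 0 < 2 * ℓ + 1
      0<2ℓ+1 = ≤-trans (s≤s z≤n) (≤-reflexive (+-comm 1 (2 * ℓ)))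

      k<2k : k < 2 * k
      k<2k = ≤-trans (≤-reflexive (+-comm 1 k)) (+-monoʳ-≤ k (≤-trans 0<k (m≤m+n k 0)))

      unused : Fin ((2 * ℓ + 1) * (2 * k * (2 * k)))
      unused = combine (fromℕ< 0<2ℓ+1) (combine (fromℕ< k<2k) (fromℕ< k<2k))

      code′ : Fin (suc N) → Fin ((2 * ℓ + 1) * (2 * k * (2 * k)))
      code′ zero    = unused
      code′ (suc i) = code i

      split : ∀ {c c′ x x′ y y′} (c< : c < 2 * ℓ + 1) (c′< : c′ < 2 * ℓ + 1)
              (x< : x < 2 * k) (x′< : x′ < 2 * k) (y< : y < 2 * k) (y′< : y′ < 2 * k) →
              combine (fromℕ< c<) (combine (fromℕ< x<) (fromℕ< y<))
                ≡ combine (fromℕ< c′<) (combine (fromℕ< x′<) (fromℕ< y′<)) →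
              c ≡ c′ × x ≡ x′ × y ≡ y′
      split c< c′< x< x′< y< y′< eq =
        let (c≡ , xy≡) = Fin.combine-injective (fromℕ< c<) _ (fromℕ< c′<) _ eq
            (x≡ , y≡)  = Fin.combine-injective (fromℕ< x<) _ (fromℕ< x′<) _ xy≡
        in Fin.fromℕ<-injective _ _ c< c′< c≡ , Fin.fromℕ<-injective _ _ x< x′< x≡
         , Fin.fromℕ<-injective _ _ y< y′< y≡

      unused≢ : ∀ i → unused ≢ code i
      unused≢ i eq = let (c≡ , k≡a , _) = split 0<2ℓ+1 (class< i) k<2k (a< i) k<2k (b< i) eq
                     in <⇒≢ (a<k i (sym c≡)) (sym k≡a)

      code′-injective : ∀ i j → code′ i ≡ code′ j → i ≡ j
      code′-injective zero    zero    eq = refl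
      code′-injective zero    (suc j) eq = contradiction eq (unused≢ j)
      code′-injective (suc i) zero    eq = contradiction (sym eq) (unused≢ i)
      code′-injective (suc i) (suc j) eq =
        let (c≡ , a≡ , b≡) = split (class< i) (class< j) (a< i) (a< j) (b< i) (b< j) eq
        in cong suc (code-injective i j c≡ a≡ b≡)

    count : N < (2 * ℓ + 1) * 2 ^ (2 * k)
    count with k ℕ.≟ 0
    ... | no k≢0   = <-≤-trans (N< (n≢0⇒n>0 k≢0)) (*-monoʳ-≤ (2 * ℓ + 1) ([2k]²≤2^2k k (n≢0⇒n>0 k≢0)))
    -- For `k = 0` a point would have `a` below zero, so there are no points.
    ... | yes refl = ≤-trans (s≤s (≮⇒≥ (λ 0<N → n≮0 (a< (fromℕ< 0<N)))))
      (≤-reflexive (sym (trans (*-identityʳ (2 * ℓ + 1)) (+-comm (2 * ℓ) 1))))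

-- Obstructions to removing a vertex

elements : (p : Subset n) → Fin ∣ p ∣ → Fin n
elements (false ∷ p) i       = suc (elements p i)
elements (true  ∷ p) zero    = zero
elements (true  ∷ p) (suc i) = suc (elements p i)

elements-∈ : (p : Subset n) (i : Fin ∣ p ∣) → elements p i ∈ p
elements-∈ (false ∷ p) i       = there (elements-∈ p i)
elements-∈ (true  ∷ p) zero    = here
elements-∈ (true  ∷ p) (suc i) = there (elements-∈ p i)

elements-injective : (p : Subset n) {i j : Fin ∣ p ∣} → elements p i ≡ elements p j → i ≡ j
elements-injective (false ∷ p) eq = elements-injective p (Fin.suc-injective eq)
elements-injective (true  ∷ p) {zero}  {zero}  eq = refl
elements-injective (true  ∷ p) {suc i} {suc j} eq = cong suc (elements-injective p (Fin.suc-injective eq))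

module Removals {n : ℕ} (𝒮 : RemovalSystem n) where

  open RemovalSystem 𝒮
  open Connectivity ρ ρ-submodular ρ-compl

  -- With `ρ≤τ` and `ρ◂≤τ` the bounds are equalities. This form of an obstruction no longer mentions
  -- the separated pair or its connectivity.
  record Blocked (o : Removal) (v : Fin n) (X : Subset n) : Set where
    field
      v∉   : v ∉ X
      τ≤ρ  : τ o v X ≤ ρ X
      τ≤ρ◂ : τ o v X ≤ ρ (X ◂ v)

  open Blocked

  -- The excess of `τ` over `ρ (_ ◂ v)` vanishes at `X`, and by `τ-down` at every subset of `X`. The
  -- other side follows by complementation and `τ-up`.
  blocked-side : ∀ {o v X Z} → Blocked o v X → OneSide v Z X → τ o v Z ≤ ρ (Z ◂ v)
  blocked-side {o} {v} {X} {Z} b (inj₁ Z⊆X) = +-cancelˡ-≤ (ρ (X ◂ v)) _ _ (begin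
    ρ (X ◂ v) + τ o v Z    ≤⟨ τ-down o (v∉ b) Z⊆X ⟩
    ρ (Z ◂ v) + τ o v X    ≤⟨ +-monoʳ-≤ _ (τ≤ρ◂ b) ⟩
    ρ (Z ◂ v) + ρ (X ◂ v)  ≡⟨ +-comm (ρ (Z ◂ v)) _ ⟩
    ρ (X ◂ v) + ρ (Z ◂ v)  ∎)
    where open ≤-Reasoning
  blocked-side {o} {v} {X} {Z} b (inj₂ Z⊆) = begin
    τ o v Z       ≡⟨ τ-compl o (λ v∈Z → x∈∁p⇒x∉p (Z⊆ v∈Z) ∈-◂ʳ) ⟩
    τ o v W       ≤⟨ +-cancelˡ-≤ (ρ X) _ _ (≤-trans (τ-up o v∉W X⊆W)
                       (≤-trans (+-monoʳ-≤ (ρ W) (τ≤ρ b)) (≤-reflexive (+-comm (ρ W) _)))) ⟩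
    ρ W           ≡⟨ ρ-compl (Z ◂ v) ⟩
    ρ (Z ◂ v)     ∎
    where
    open ≤-Reasoning
    W = ∁ (Z ◂ v)
    v∉W : v ∉ W
    v∉W v∈W = x∈∁p⇒x∉p v∈W ∈-◂ʳ
    X⊆W : X ⊆ W
    X⊆W x∈X = x∉p⇒x∈∁p (∉-◂ (λ x∈Z → x∈∁p⇒x∉p (Z⊆ x∈Z) (∈-◂ˡ x∈X)) (λ { refl → v∉ b x∈X }))

  -- Both `τ` values of `Z` are at most `ρ (Z ◂ v)`, while their sum exceeds `ρ Z + ρ (Z ◂ v)`.
  blocked-strict : ∀ {o o′ v X Y Z} → Blocked o v X → Blocked o′ v Y → o ≢ o′ →
                   OneSide v Z X → OneSide v Z Y → ρ Z < ρ (Z ◂ v)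
  blocked-strict {o} {o′} {v} {X} {Y} {Z} b b′ o≢o′ ZX ZY =
    +-cancelʳ-< (ρ (Z ◂ v)) _ _ (<-≤-trans (τ-both o o′ o≢o′)
      (+-mono-≤ (blocked-side b ZX) (blocked-side b′ ZY)))
    where
    τ-both : ∀ o o′ → o ≢ o′ → ρ Z + ρ (Z ◂ v) < τ o v Z + τ o′ v Z
    τ-both delete   delete   o≢o′ = contradiction refl o≢o′
    τ-both contract contract o≢o′ = contradiction refl o≢o′
    τ-both delete   contract _    = τ-delete-contract v Z
    τ-both contract delete   _    = ≤-trans (τ-delete-contract v Z) (≤-reflexive (+-comm (τ delete v Z) _))

  -- Since `τ` is one more than the cut-rank after removal, `τ≤` witnesses a connectivity below `k`
  -- after removal.
  record Obstruction (Q R : Subset n) (k : ℕ) (o : Removal) (v : Fin n) : Set where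
    field
      set  : Subset n
      sep  : Separates Q R set
      v∉   : v ∉ set
      τ≤   : τ o v set ≤ k

  open Obstruction public

  module _ {Q R : Subset n} {k : ℕ} (linked : Linked Q R k) {v : Fin n} (v∉R : v ∉ R) where

    module _ {o : Removal} (ob : Obstruction Q R k o v) where

      obstruction-tight : Tight Q R k (set ob)
      obstruction-tight = record { separates = sep ob ; ρ≤ = ≤-trans (ρ≤τ o v (v∉ ob)) (τ≤ ob) }

      obstruction-tight◂ : Tight Q R k (set ob ◂ v)
      obstruction-tight◂ = record
        { separates = separates-◂ (sep ob) v∉R
        ; ρ≤        = ≤-trans (ρ◂≤τ o v (set ob)) (τ≤ ob) }

      obstruction-blocked : Blocked o v (set ob)
      obstruction-blocked = record
        { v∉   = v∉ ob
        ; τ≤ρ  = ≤-trans (τ≤ ob) (linked (separates obstruction-tight))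
        ; τ≤ρ◂ = ≤-trans (τ≤ ob) (linked (separates obstruction-tight◂))
        }

      ∩-tight◂ : ∀ {A} → Tight Q R k (A ◂ v) → Tight Q R k ((set ob ∩ A) ◂ v)
      ∩-tight◂ {A} a◂ = subst (Tight Q R k) (sym (∪-distribʳ-∩ ⁅ v ⁆ (set ob) A))
        (tight-∩ linked obstruction-tight◂ a◂)

      -- Uncrossing replaces the obstructing sets by members of a chain. The same removal is blocked
      -- there too: intersect with the obstruction, where `blocked-side` applies, and return to `A`
      -- by `τ-up`.
      blocked-transfer : ∀ {A} → v ∉ A → Tight Q R k A → Tight Q R k (A ◂ v) → Blocked o v A
      blocked-transfer {A} v∉A a a◂ = record
        { v∉   = v∉A
        ; τ≤ρ  = ≤-trans τA≤k (linked (separates a))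
        ; τ≤ρ◂ = ≤-trans τA≤k (linked (separates a◂))
        }
        where
        Z = set ob ∩ A

        τA≤k : τ o v A ≤ k
        τA≤k = +-cancelˡ-≤ k _ _ (begin
          k + τ o v A    ≤⟨ +-monoˡ-≤ _ (linked (separates-∩ (sep ob) (separates a))) ⟩
          ρ Z + τ o v A  ≤⟨ τ-up o v∉A (p∩q⊆q (set ob) A) ⟩
          ρ A + τ o v Z  ≤⟨ +-mono-≤ (ρ≤ a) (≤-trans (blocked-side obstruction-blocked (inj₁ (p∩q⊆p (set ob) A)))
                                                     (ρ≤ (∩-tight◂ a◂))) ⟩
          k + k          ∎)
          where open ≤-Reasoning

    -- For different removals, the intersection of the two obstructing sets would gain cut-rank when
    -- `v` is added, yet by uncrossing it is a minimum cut with and without `v`.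
    obstructions-agree : ∀ {o o′} → Obstruction Q R k o v → Obstruction Q R k o′ v → ¬ o ≢ o′
    obstructions-agree x y o≢o′ = <⇒≱
      (blocked-strict (obstruction-blocked x) (obstruction-blocked y) o≢o′
        (inj₁ (p∩q⊆p (set x) (set y))) (inj₁ (p∩q⊆q (set x) (set y))))
      (≤-trans (ρ≤ (∩-tight◂ x (obstruction-tight◂ y)))
               (linked (separates-∩ (sep x) (sep y))))

  module _ {N : ℕ} {p : Fin N → Fin n} (p-injective : ∀ {i j} → p i ≡ p j → i ≡ j)
           {Q R : Subset n} {k : ℕ} (linked : Linked Q R k) (p∉R : ∀ i → p i ∉ R)
           {o : Fin N → Removal} (ob : ∀ i → Obstruction Q R k (o i) (p i)) where

    private
      module Ch = Chain p p-injective (Tight Q R k) (tight-∩ linked) (tight-∪ linked)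
        (set ∘ ob) (v∉ ∘ ob) (λ i → obstruction-tight linked (p∉R i) (ob i))
        (λ i → obstruction-tight◂ linked (p∉R i) (ob i))

    obstruction-chain : TightChain p Q R k
    obstruction-chain = record
      { set    = Ch.chain (allFin N)
      ; tight  = Ch.chain-P (allFin N)
      ; tight◂ = Ch.chain-P◂ (allFin N)
      ; ∉set   = Ch.chain-∉ (allFin N)
      ; total  = Ch.chain-total (allFin N) (∈-allFin _) (∈-allFin _)
      }

    obstruction-chain-blocked : ∀ i → Blocked (o i) (p i) (TightChain.set obstruction-chain i)
    obstruction-chain-blocked i = blocked-transfer linked (p∉R i) (ob i)
      (Ch.chain-∉ (allFin N) i) (Ch.chain-P (allFin N) i) (Ch.chain-P◂ (allFin N) i)

  obstructed-< : ∀ {N} {p : Fin N → Fin n} → (∀ {i j} → p i ≡ p j → i ≡ j) →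
                 ∀ {Q R S T k ℓ} → Linked Q R k → Linked S T ℓ → S ⟂ T →
                 (∀ i → p i ∉ R) → (∀ i → p i ∉ S) → (∀ i → p i ∉ T) →
                 (∀ i → ∃ λ o → ∃ λ o′ → o ≢ o′ × Obstruction Q R k o (p i) × Obstruction S T ℓ o′ (p i)) →
                 N < (2 * ℓ + 1) * 2 ^ (2 * k)
  obstructed-< {N} {p} p-injective {Q} {R} {S} {T} {k} {ℓ} QR ST S⟂T p∉R p∉S p∉T obs
    with S′ , T′ , S′⊆S , T′⊆T , ∣S′∣≤ , ∣T′∣≤ , ST′ ← linked-core S⟂T ST =
    Grid.Count.count ρ ρ-⊥ ρ-submodular ρ-compl QR ST ST′ S′⊆S T′⊆T ∣S′∣≤ ∣T′∣≤ p∉S p∉T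
      (obstruction-chain p-injective QR p∉R x) (obstruction-chain p-injective ST p∉T y)
      (λ i → blocked-strict (obstruction-chain-blocked p-injective QR p∉R x i)
                            (obstruction-chain-blocked p-injective ST p∉T y i) (o≢o′ i))
    where
    o  = proj₁ ∘ obs
    o′ = proj₁ ∘ proj₂ ∘ obs

    o≢o′ : ∀ i → o i ≢ o′ i
    o≢o′ = proj₁ ∘ proj₂ ∘ proj₂ ∘ obs

    x : ∀ i → Obstruction Q R k (o i) (p i)
    x = proj₁ ∘ proj₂ ∘ proj₂ ∘ proj₂ ∘ obs

    y : ∀ i → Obstruction S T ℓ (o′ i) (p i)
    y = proj₂ ∘ proj₂ ∘ proj₂ ∘ proj₂ ∘ obs

-- From changed connectivity to obstructions and the final count

module _ (G : Graph n) where

  private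
    𝒮 : RemovalSystem n
    𝒮 = CutOf.removalSystem G

    Linked : Subset n → Subset n → ℕ → Set
    Linked = Submodular.Linked (CutOf.ρ G) (CutOf.ρ-submodular G)

    Obstruction : Subset n → Subset n → ℕ → Removal → Fin n → Set
    Obstruction = Removals.Obstruction 𝒮

  κ-linked : ∀ {Q R k} → Q ⊆ V G → κ G Q R ≡ k → Linked Q R k
  κ-linked Q⊆V κ≡k sX = ≤-trans (≤-reflexive (sym κ≡k)) (κ≤ρ G Q⊆V sX)

  module _ {Q R : Subset n} {k : ℕ} (Q⊆V : Q ⊆ V G) (Q⟂R : Q ⟂ R) (κ≡k : κ G Q R ≡ k)
           {v : Fin n} (v∉Q : v ∉ Q) where

    attained : ∃ λ X → Separates Q R X × CutOf.ρ G X ≤ k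
    attained =
      let (X , sX , _ , r) = κ-separation G Q⊆V Q⟂R
      in X , sX , ≤-trans (ρ≤cutRank G X) (≤-trans r (≤-reflexive κ≡k))

    -- Deletion never raises the connectivity, so a value different from `k` is below `k`, and a
    -- minimum cut of `G ∖ v` is an obstruction.
    delete-obstruction : κ (G ∖ v) Q R ≢ k → Obstruction Q R k delete v
    delete-obstruction κ≢k =
      let (X , sX , ρX≤k)    = attained
          (Y , sY , v∉Y , r) = κ-∖-separation G Q⊆V v∉Q Q⟂R
      in record
        { set = Y ; sep = sY ; v∉ = v∉Y
        ; τ≤ = ≤-trans (s≤s r) (≤∧≢⇒< (≤-trans (κ-∖≤ρ G Q⊆V v∉Q sX) ρX≤k) κ≢k) }

    -- Pivoting does not raise any cut-rank, so again a changed value is smaller; `rank-pivot-∖`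
    -- carries the cut back to `G`.
    contract-obstruction : ∀ {u} → Adjacent G v u → κ (pivot G u v ∖ v) Q R ≢ k →
                           Obstruction Q R k contract v
    contract-obstruction {u} vu κ≢k =
      let (X , sX , ρX≤k)    = attained
          (Y , sY , v∉Y , r) = κ-∖-separation (pivot G u v) Q⊆V v∉Q Q⟂R
      in record
        { set = Y ; sep = sY ; v∉ = v∉Y
        ; τ≤ = ≤-trans (rank-pivot-∖ G vu v∉Y) (≤-trans (s≤s r)
            (≤∧≢⇒< (≤-trans (κ-∖≤ρ (pivot G u v) Q⊆V v∉Q sX) (≤-trans (ρ-pivot≤ G u v X) ρX≤k)) κ≢k)) }

corollary1p3 : ∀ {n : ℕ} (G : Graph n) (Q R S T : Subset n) (k ℓ : ℕ) →
    Q ⊆ V G → R ⊆ V G → S ⊆ V G → T ⊆ V G →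
    Empty (Q ∩ R) → Empty (S ∩ T) →
    κ G Q R ≡ k → κ G S T ≡ ℓ →
    let F = V G ─ (Q ∪ R ∪ S ∪ T) in
    ∣ F ∣ ≥ (2 * ℓ + 1) * 2 ^ (2 * k) →
    ∃ λ (v : Fin n) → v ∈ F ×
    ( (κ (G ∖ v) Q R ≡ k × κ (G ∖ v) S T ≡ ℓ)
    ⊎ (∀ (u : Fin n) → Adjacent G v u →
    κ (pivot G u v ∖ v) Q R ≡ k × κ (pivot G u v ∖ v) S T ≡ ℓ))
corollary1p3 {n} G Q R S T k ℓ Q⊆V R⊆V S⊆V T⊆V Q∩R=∅ S∩T=∅ κQR κST ∣F∣≥ =
  decidable-stable (Fin.any? good?) crowded
  where
  F : Subset n
  F = V G ─ (Q ∪ R ∪ S ∪ T)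

  Keeps : (Subset n → Subset n → ℕ) → Set
  Keeps κ′ = κ′ Q R ≡ k × κ′ S T ≡ ℓ

  keeps? : ∀ κ′ → Dec (Keeps κ′)
  keeps? κ′ = κ′ Q R ℕ.≟ k ×-dec κ′ S T ℕ.≟ ℓ

  Good : Fin n → Set
  Good v = v ∈ F × (Keeps (κ (G ∖ v)) ⊎ (∀ u → Adjacent G v u → Keeps (κ (pivot G u v ∖ v))))

  pivot? : ∀ v u → Dec (Adjacent G v u → Keeps (κ (pivot G u v ∖ v)))
  pivot? v u = Bool.T? (adj G v u) →-dec keeps? (κ (pivot G u v ∖ v))

  good? : ∀ v → Dec (Good v)
  good? v = v ∈? F ×-dec (keeps? (κ (G ∖ v)) ⊎-dec Fin.all? (pivot? v))

  𝒮 = CutOf.removalSystem G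

  open Removals 𝒮 using (Obstruction; obstructions-agree; obstructed-<)

  QR = κ-linked G Q⊆V κQR
  ST = κ-linked G S⊆V κST

  Q⟂R : Q ⟂ R
  Q⟂R q r = Q∩R=∅ (_ , x∈p∩q⁺ (q , r))
  S⟂T : S ⟂ T
  S⟂T s t = S∩T=∅ (_ , x∈p∩q⁺ (s , t))

  ∉parts : ∀ {v} → v ∈ F → (v ∉ Q × v ∉ R) × (v ∉ S × v ∉ T)
  ∉parts v∈F =
    let ∉∪ = proj₂ (∈-─⁻ (V G) (Q ∪ R ∪ S ∪ T) v∈F)
    in ( (∉∪ ∘ x∈p∪q⁺ ∘ inj₁)
       , (∉∪ ∘ x∈p∪q⁺ ∘ inj₂ ∘ x∈p∪q⁺ ∘ inj₁))
     , ( (∉∪ ∘ x∈p∪q⁺ ∘ inj₂ ∘ x∈p∪q⁺ ∘ inj₂ ∘ x∈p∪q⁺ ∘ inj₁)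
       , (∉∪ ∘ x∈p∪q⁺ ∘ inj₂ ∘ x∈p∪q⁺ ∘ inj₂ ∘ x∈p∪q⁺ ∘ inj₂))

  Obstructed : Removal → Fin n → Set
  Obstructed o v = Obstruction Q R k o v ⊎ Obstruction S T ℓ o v

  violated : ∀ {κ′ o v} → ¬ Keeps κ′ →
             (κ′ Q R ≢ k → Obstruction Q R k o v) → (κ′ S T ≢ ℓ → Obstruction S T ℓ o v) → Obstructed o v
  violated {κ′} ¬keeps qr st with κ′ Q R ℕ.≟ k
  ... | no ≢k  = inj₁ (qr ≢k)
  ... | yes ≡k = inj₂ (st (λ ≡ℓ → ¬keeps (≡k , ≡ℓ)))

  bad : ∀ {v} → v ∈ F → ¬ Good v →
        ∃ λ o → ∃ λ o′ → o ≢ o′ × Obstruction Q R k o v × Obstruction S T ℓ o′ v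
  bad {v} v∈F ¬good with ∉parts v∈F
  ... | (v∉Q , v∉R) , (v∉S , v∉T) = cross deleted contracted
    where
    deleted : Obstructed delete v
    deleted = violated {κ (G ∖ v)} (λ keeps → ¬good (v∈F , inj₁ keeps))
      (delete-obstruction G Q⊆V Q⟂R κQR v∉Q) (delete-obstruction G S⊆V S⟂T κST v∉S)

    contracted : Obstructed contract v
    -- `τ contract` does not depend on the neighbour, so one failing neighbour is enough.
    contracted with Fin.¬∀⟶∃¬ n _ (pivot? v) (λ keeps → ¬good (v∈F , inj₂ keeps))
    ... | u , ¬imp with Bool.T? (adj G v u)
    ...   | no ¬vu = contradiction (λ vu → contradiction vu ¬vu) ¬imp
    ...   | yes vu = violated {κ (pivot G u v ∖ v)} (λ keeps → ¬imp (λ _ → keeps))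
        (contract-obstruction G Q⊆V Q⟂R κQR v∉Q vu) (contract-obstruction G S⊆V S⟂T κST v∉S vu)

    cross : Obstructed delete v → Obstructed contract v →
            ∃ λ o → ∃ λ o′ → o ≢ o′ × Obstruction Q R k o v × Obstruction S T ℓ o′ v
    -- The two removals cannot both fail on the same pair, so each pair is obstructed by exactly one
    -- of the two chosen failures.
    cross (inj₁ x) (inj₁ y) = contradiction (λ ()) (obstructions-agree QR v∉R x y)
    cross (inj₂ x) (inj₂ y) = contradiction (λ ()) (obstructions-agree ST v∉T x y)
    cross (inj₁ x) (inj₂ y) = delete , contract , (λ ()) , x , y
    cross (inj₂ x) (inj₁ y) = contract , delete , (λ ()) , y , x

  crowded : ¬ ¬ ∃ Good
  crowded none = <⇒≱ (obstructed-< (elements-injective F) QR ST S⟂T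
      (proj₂ ∘ proj₁ ∘ parts) (proj₁ ∘ proj₂ ∘ parts) (proj₂ ∘ proj₂ ∘ parts)
      (λ i → bad (elements-∈ F i) (λ good → none (_ , good))))
    ∣F∣≥
    where
    parts : ∀ i → _
    parts i = ∉parts (elements-∈ F i)
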